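{- For every $n\ge1$ and every $\pi\in\mathrm{NCCP}(n;312)$, $$(\psi\circ\phi^{ -1})(\alpha(\pi))=\overline{\pi}=\alpha'\big((\psi\circ\phi^{ -1})(\pi)\big),$$ i.e. the square formed by $\alpha:\mathrm{NCCP}(n;312)\to\mathrm{NCCP}(n;312)$, $\alpha':\mathrm{NCP}(n)\to\mathrm{NCP}(n)$ and the two vertical maps $\psi\circ\phi^{ -1}:\mathrm{NCCP}(n;312)\to\mathrm{NCP}(n)$, together with its diagonal $\pi\mapsto\overline\pi$ from the upper left $\mathrm{NCCP}(n;312)$ to the lower right $\mathrm{NCP}(n)$, is commutative.
   Context: **Noncommutative crossing partitions.** Let $[n]=\{1,\dots,n\}$. A noncommutative crossing partition of $[n]$ is a finite sequence $\pi=(\pi_1,\dots,\pi_l)$, written $\pi_1/\cdots/\pi_l$, of nonempty blocks such that each $p\in[n]$ appears exactly once, each block is written increasingly, and $\max(\pi_i)>\min(\pi_{i+1})$ for $1\le i\le l-1$. $\mathrm{NCCP}(n)$ is the set of these. Concatenating the blocks gives a permutation of $[n]$ in one-line notation which determines $\pi$ (slashes sit exactly at the descents); $\pi$ is identified with this permutation. For a pattern $\sigma\in\{312,132\}$, $\mathrm{NCCP}(n;\sigma)$ is the subset of those $\pi$ whose permutation avoids $\sigma$. $\mathrm{NCP}(n)$ is the set of $\pi\in\mathrm{NCCP}(n)$ that are non-crossing (no $a<b<c<d$ and $i\neq j$ with $a,c\in\pi_i$, $b,d\in\pi_j$) and canonical ($\min(\pi_l)<\cdots<\min(\pi_1)$).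 One has $\mathrm{NCP}(n)=\mathrm{NCCP}(n;132)$. **Maps $\phi$ and $\psi$.** A labeled binary tree with $n$ nodes is a rooted tree in which each node has at most one left child and at most one right child, labeled bijectively by $[n]$ with labels increasing from root to leaves. $\phi$ sends such a tree to the permutation obtained by reading labels in in-order (left subtree, root, right subtree); it is a bijection onto $\mathrm{NCCP}(n)$. $\psi$ sends such a tree to the canonical partition obtained by deleting all left edges, taking the labels of each resulting chain of right edges as a block, and arranging blocks with decreasing minima. The map $\psi\circ\phi^{ -1}$ restricts to a bijection $\mathrm{NCCP}(n;312)\to\mathrm{NCP}(n)$; write $\phi\circ\psi^{ -1}:\mathrm{NCP}(n)\to\mathrm{NCCP}(n;312)$ for its inverse. **Bar and $\alpha$.** For $\pi\in\mathrm{NCCP}(n)$, $\overline\pi$ is obtained by replacing each letter $i$ of the one-line notation of $\pi$ by $n+1-i$ (slashes are re-inserted at descents). E.g. $\overline{15/46/23}=6/23/15/4$. Bar maps $\mathrm{NCCP}(n;312)$ bijectively to $\mathrm{NCCP}(n;132)=\mathrm{NCP}(n)$. Define $\alpha(\pi)=(\phi\circ\psi^{ -1})(\overline\pi)$ for $\pi\in\mathrm{NCCP}(n;312)$. **The map $\alpha'$ (Simion–Ullman involution).** Place points $1,2,\dots,n$ clockwise on a circle. Insert a new point between each pair of cyclically consecutive points; the one between $n$ and $1$ is labeled $1'$ and the remaining ones are labeled $2',3',\dots,n'$ going counterclockwise (so $i'$ lies between $n+1-i$ and $n+2-i$ for $2\le i\le n$). For $\pi\in\mathrm{NCP}(n)$,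 draw the convex hulls of its blocks in the disc; $i'$ and $j'$ are in the same block of $\alpha'(\pi)$ iff they lie in the same region of the complement. Dropping primes and arranging the blocks in canonical order gives $\alpha'(\pi)\in\mathrm{NCP}(n)$. E.g. $\alpha'(5/3/124)=5/34/12$.
   Formalization: The disc, the points on the circle, the convex hulls and the regions defining α′ are taken in the rational plane: points have rational coordinates, and two points lie in the same region when a polygonal path with rational vertices joins them off the hulls. -}

module Defs where

open import Data.Bool.Base using (if_then_else_)
open import Data.Empty using (⊥)
open import Data.Fin.Base as Fin using (Fin)
open import Data.Integer.Base as ℤ using (+_)
open import Data.List.Base using (List; []; _∷_; _++_; map; foldr; length; lookup; concatMap; upTo)
open import Data.List.Membership.Propositional using (_∈_)
open import Data.List.NonEmpty as List⁺ using (List⁺; _∷_; _∷⁺_)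
open import Data.List.Relation.Binary.Permutation.Propositional using (_↭_)
open import Data.List.Relation.Unary.All using (All)
open import Data.List.Relation.Unary.Any using (Any)
open import Data.List.Relation.Unary.Linked using (Linked)
import Data.List.Sort as Sort
open import Data.Nat.Base using (ℕ; suc; _+_; _*_; _∸_; _≤_; _<_; _>_; _⊓_; _⊔_)
open import Data.Nat.Properties using (_<?_; ≤-decTotalOrder)
open import Data.Product.Base using (Σ-syntax; ∃-syntax; _×_; _,_; proj₁; proj₂)
open import Data.Rational.Base as ℚ using (ℚ; 0ℚ; 1ℚ)
open import Data.Tree.Binary using (Tree; leaf; node; module Infix)
import Data.Tree.Binary.Relation.Unary.All as Tree
open import Data.Unit.Base using (⊤)
open import Function.Bundles using (_⇔_)
open import Level using (0ℓ)
open import Relation.Binary.Bundles using (DecTotalOrder)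
open import Relation.Binary.Construct.Closure.ReflexiveTransitive using (Star)
import Relation.Binary.Construct.Flip.EqAndOrd as Flip
import Relation.Binary.Construct.On as On
open import Relation.Binary.PropositionalEquality.Core using (_≡_; _≢_)
open import Relation.Nullary using (¬_; does)

Block : Set
Block = List⁺ ℕ

Blocks : Set
Blocks = List Block

letters : Block → List ℕ
letters = List⁺.toList

minB maxB : Block → ℕ
minB = List⁺.foldr₁ _⊓_
maxB = List⁺.foldr₁ _⊔_

[1⋯_] : ℕ → List ℕ
[1⋯ n ] = map suc (upTo n)

word : Blocks → List ℕ
word = concatMap letters

record NCCP (n : ℕ) (π : Blocks) : Set where
  field
    exactlyOnce : word π ↭ [1⋯ n ]
    increasing  : All (λ b → Linked _<_ (letters b)) π
    descents    : Linked (λ b c → maxB b > minB c) π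

Contains : List ℕ → List ℕ → Set
Contains τ w =
  Σ[ f ∈ (Fin (length τ) → Fin (length w)) ]
    (∀ i j → i Fin.< j → f i Fin.< f j) ×
    (∀ i j → lookup τ i < lookup τ j ⇔ lookup w (f i) < lookup w (f j))

p312 : List ℕ
p312 = 3 ∷ 1 ∷ 2 ∷ []

NCCP-avoiding : ℕ → List ℕ → Blocks → Set
NCCP-avoiding n τ π = NCCP n π × ¬ Contains τ (word π)

NonCrossing : Blocks → Set
NonCrossing π = ∀ {a b c d} (i j : Fin (length π)) → i ≢ j →
  a < b → b < c → c < d →
  a ∈ letters (lookup π i) → c ∈ letters (lookup π i) →
  b ∈ letters (lookup π j) → d ∈ letters (lookup π j) → ⊥

record NCP (n : ℕ) (π : Blocks) : Set where
  field
    nccp        : NCCP n π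
    nonCrossing : NonCrossing π
    canonical   : Linked (λ b c → minB b > minB c) π

prependLetter : ℕ → Blocks → Blocks
prependLetter x []       = List⁺.[ x ] ∷ []
prependLetter x (b ∷ bs) =
  if does (x <? List⁺.head b) then (x ∷⁺ b) ∷ bs else List⁺.[ x ] ∷ b ∷ bs

-- The inverse of word on partitions with slashes exactly at the descents.
slash : List ℕ → Blocks
slash = foldr prependLetter []

bar : ℕ → Blocks → Blocks
bar n π = slash (map (λ i → suc n ∸ i) (word π))

-- The nodes carry the labels; a leaf is an absent child.
BinTree : Set
BinTree = Tree ℕ ⊤

data Increasing : BinTree → Set where
  leaf : ∀ {u} → Increasing (leaf u)
  node : ∀ {l x r} →
         Tree.All (x <_) (λ _ → ⊤) l → Tree.All (x <_) (λ _ → ⊤) r →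
         Increasing l → Increasing r → Increasing (node l x r)

record LabeledTree (n : ℕ) (t : BinTree) : Set where
  field
    labels     : Infix.toList t ↭ [1⋯ n ]
    increasing : Increasing t

φ : BinTree → Blocks
φ t = slash (Infix.toList t)

rightSpine : BinTree → List ℕ
rightSpine (leaf _)     = []
rightSpine (node l x r) = x ∷ rightSpine r

-- The chains of right edges left after deleting all left edges;
-- chainsBelow omits the chain through the root.
mutual
  chains : BinTree → Blocks
  chains (leaf _)         = []
  chains t@(node l x r)   = (x ∷ rightSpine r) ∷ chainsBelow t

  chainsBelow : BinTree → Blocks
  chainsBelow (leaf _)     = []
  chainsBelow (node l x r) = chains l ++ chainsBelow r

decreasingMinima : DecTotalOrder 0ℓ 0ℓ 0ℓ
decreasingMinima = On.decTotalOrder (Flip.decTotalOrder ≤-decTotalOrder) minB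

ψ : BinTree → Blocks
ψ t = Sort.sort decreasingMinima (chains t)

-- Maps given by inverses or by a characterisation of their value are
-- represented by their graphs: F ∶ x ↦ y says that F is defined at x,
-- single-valued there, and has value y.
infix 4 _∶_↦_
_∶_↦_ : (Blocks → Blocks → Set) → Blocks → Blocks → Set
F ∶ x ↦ y = F x y × (∀ z → F x z → z ≡ y)

ψ∘φ⁻¹ : ℕ → Blocks → Blocks → Set
ψ∘φ⁻¹ n π σ = ∃[ t ] LabeledTree n t × φ t ≡ π × ψ t ≡ σ

-- The inverse of the restriction of ψ∘φ⁻¹ to 312-avoiding partitions.
φ∘ψ⁻¹ : ℕ → Blocks → Blocks → Set
φ∘ψ⁻¹ n σ π = NCCP-avoiding n p312 π × ψ∘φ⁻¹ n π σ

α : ℕ → Blocks → Blocks → Set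
α n π = φ∘ψ⁻¹ n (bar n π)

-- The plane over ℚ.
Point : Set
Point = ℚ × ℚ

-- As t grows from 0 to ∞, this runs clockwise along the unit circle
-- from (0 , 1) towards (0 , -1).
circlePoint : ℕ → Point
circlePoint t = (+ (2 * t)) ℚ./ suc (t * t) , (1 ℤ.⊖ t * t) ℚ./ suc (t * t)

-- Parameters are doubled to make room for the primed points: i′ lies
-- halfway between n + 1 - i and n + 2 - i, so that 1′ comes after n and
-- hence, on the circle, between n and 1.
unprimed : ℕ → Point
unprimed p = circlePoint (2 * p)

primed : ℕ → ℕ → Point
primed n i = circlePoint (2 * n + 3 ∸ 2 * i)

sumℚ : List ℚ → ℚ
sumℚ = foldr ℚ._+_ 0ℚ

record InHull (b : Block) (z : Point) : Set where
  field
    weight      : ℕ → ℚ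
    nonNegative : All (λ p → 0ℚ ℚ.≤ weight p) (letters b)
    total       : sumℚ (map weight (letters b)) ≡ 1ℚ
    abscissa    : sumℚ (map (λ p → weight p ℚ.* proj₁ (unprimed p)) (letters b)) ≡ proj₁ z
    ordinate    : sumℚ (map (λ p → weight p ℚ.* proj₂ (unprimed p)) (letters b)) ≡ proj₂ z

InDisc : Point → Set
InDisc (x , y) = x ℚ.* x ℚ.+ y ℚ.* y ℚ.≤ 1ℚ

InComplement : Blocks → Point → Set
InComplement π z = InDisc z × All (λ b → ¬ InHull b z) π

along : Point → Point → ℚ → Point
along (x , y) (x′ , y′) s = x ℚ.+ s ℚ.* (x′ ℚ.- x) , y ℚ.+ s ℚ.* (y′ ℚ.- y)

SegmentInComplement : Blocks → Point → Point → Set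
SegmentInComplement π z w =
  ∀ s → 0ℚ ℚ.≤ s → s ℚ.≤ 1ℚ → InComplement π (along z w s)

-- Regions are the components of the complement under polygonal paths.
SameRegion : Blocks → Point → Point → Set
SameRegion π = Star (SegmentInComplement π)

SameBlock : Blocks → ℕ → ℕ → Set
SameBlock π i j = Any (λ b → i ∈ letters b × j ∈ letters b) π

α′ : ℕ → Blocks → Blocks → Set
α′ n π ρ = NCP n ρ ×
  (∀ i j → 1 ≤ i → i ≤ n → 1 ≤ j → j ≤ n →
     SameBlock ρ i j ⇔ SameRegion π (primed n i) (primed n j))

{-# OPTIONS --safe #-}

-- The tree of a word is labelled in preorder exactly when the word avoids 312, and for such trees ψ merely
-- reverses the list of right chains, from which the tree can be rebuilt.  The bar of the in-order word of t
-- is again the chain partition of a preorder-labelled tree, kreweras t: at a node with subtrees l and r,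
-- append the barred label to the right spine of the image of l and hang the result below the node of the
-- image of r that is last in preorder.  Hence α sends φ t to φ (kreweras t).
--
-- For α′, put h = n + 1 - i, so that i′ sits at h + ½.  By induction on the tree, k and m lie in the same
-- descending run of the word of t if and only if no chain of t has labels both inside and outside (k, m].
-- If no chain does, every hull lies strictly on one side of the chord from k + ½ to m + ½, so the chord is
-- a path in the complement.  If a chain contains p inside and q outside, the chord p q belongs to its hull
-- and separates the two points.  Sides are measured by determinants of triples of circle points, which are
-- Vandermonde products of the parameters.
module Submission where

open import Defs

-- The maps are given as graphs, so every arrow needs a value and its uniqueness. Increasing trees
-- with equal in-order words coincide, which settles `ψ∘φ⁻¹`. But `ψ` is not injective on increasing
-- trees (six trees on three labels, five partitions), so its inverse is treated on preorder labels,
-- where each subtree occupies an interval (a, b]. The one equation ψ (kreweras t) = bar (φ t) then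
-- yields the triangle through α. For the triangle through α′, the comparison of runs with chains
-- does not close under induction on pairs k < m alone: if k is the root, a question about (k, m]
-- becomes, in the left subtree with last label c, one about (m, c]. Membership in the last run is
-- therefore carried along as a second statement. The components of the complement are never
-- classified. Half-points in one region turn out to be joined by a single chord; otherwise the side
-- of one chord of one hull is constant along every polygonal path but differs at the two points.
-- All of this stays inside ℚ, since an affine function that changes sign on a rational segment has
-- a rational zero there.

module Geometry where

  open import Data.Bool.Base using (Bool; false; if_then_else_; true)
  open import Data.Integer.Base as ℤ using (+_; ℤ)
  import Data.Integer.Properties as ℤ
  open import Data.List.Base using ([]; _∷_; map)
  open import Data.List.Membership.Propositional using (_∈_; _∉_)
  open import Data.List.Relation.Unary.All as All using (All; []; _∷_)
  open import Data.List.Relation.Unary.All.Properties using (All¬⇒¬Any)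
  open import Data.List.Relation.Unary.AllPairs using ([]; _∷_)
  open import Data.List.Relation.Unary.Any using (here; there)
  open import Data.List.Relation.Unary.Unique.Propositional using (Unique)
  open import Data.Nat.Base as ℕ using (suc; ℕ)
  import Data.Nat.Properties as ℕ
  open import Data.Product.Base using (_,_; _×_; proj₁; proj₂; ∃-syntax)
  open import Data.Rational.Base as ℚ using (-_; 0ℚ; 1/_; 1ℚ; _*_; _+_; _-_; fromℚᵘ; ℚ)
  import Data.Rational.Properties as ℚ
  open import Data.Rational.Solver using (module +-*-Solver)
  open import Data.Rational.Unnormalised.Base as ℚᵘ using (*≡*; mkℚᵘ; ℚᵘ)
  import Data.Rational.Unnormalised.Properties as ℚᵘ
  open import Data.Sum.Base using (_⊎_; inj₁; inj₂)
  open import Function.Base using (_∘_; id)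
  open import Relation.Binary.Construct.Closure.ReflexiveTransitive using (_◅_; ε)
  open import Relation.Binary.Definitions using (tri<; tri>; tri≈)
  open import Relation.Binary.PropositionalEquality
  open import Relation.Nullary using (contradiction; does; no; yes; ¬_)
  open import Relation.Nullary.Decidable using (dec-false; dec-true; decidable-stable)

  open +-*-Solver using (solve; _:=_; _:+_; _:*_; _:-_; con)

  -- Embedding the integers in ℚ.

  fromℚᵘ-homo-+ : ∀ p q → fromℚᵘ (p ℚᵘ.+ q) ≡ fromℚᵘ p + fromℚᵘ q
  fromℚᵘ-homo-+ p q = ℚ.toℚᵘ-injective (ℚᵘ.≃-trans (ℚ.toℚᵘ-fromℚᵘ (p ℚᵘ.+ q)) (ℚᵘ.≃-sym
    (ℚᵘ.≃-trans (ℚ.toℚᵘ-homo-+ (fromℚᵘ p) (fromℚᵘ q))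
      (ℚᵘ.+-cong (ℚ.toℚᵘ-fromℚᵘ p) (ℚ.toℚᵘ-fromℚᵘ q)))))

  fromℚᵘ-homo-* : ∀ p q → fromℚᵘ (p ℚᵘ.* q) ≡ fromℚᵘ p * fromℚᵘ q
  fromℚᵘ-homo-* p q = ℚ.toℚᵘ-injective (ℚᵘ.≃-trans (ℚ.toℚᵘ-fromℚᵘ (p ℚᵘ.* q)) (ℚᵘ.≃-sym
    (ℚᵘ.≃-trans (ℚ.toℚᵘ-homo-* (fromℚᵘ p) (fromℚᵘ q))
      (ℚᵘ.*-cong (ℚ.toℚᵘ-fromℚᵘ p) (ℚ.toℚᵘ-fromℚᵘ q)))))

  fromℤ : ℤ → ℚ
  fromℤ i = i ℚ./ 1

  fromℤ-+ : ∀ i j → fromℤ (i ℤ.+ j) ≡ fromℤ i + fromℤ j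
  fromℤ-+ i j = trans (ℚ.fromℚᵘ-cong {mkℚᵘ (i ℤ.+ j) 0} {mkℚᵘ i 0 ℚᵘ.+ mkℚᵘ j 0}
      (*≡* (cong (ℤ._* (+ 1)) (sym (cong₂ ℤ._+_ (ℤ.*-identityʳ i) (ℤ.*-identityʳ j))))))
    (fromℚᵘ-homo-+ (mkℚᵘ i 0) (mkℚᵘ j 0))

  fromℤ-* : ∀ i j → fromℤ (i ℤ.* j) ≡ fromℤ i * fromℤ j
  fromℤ-* i j = fromℚᵘ-homo-* (mkℚᵘ i 0) (mkℚᵘ j 0)

  fromℤ-neg : ∀ i → fromℤ (ℤ.- i) ≡ - fromℤ i
  fromℤ-neg i = ℚ.toℚᵘ-injective (ℚᵘ.≃-trans (ℚ.toℚᵘ-fromℚᵘ (mkℚᵘ (ℤ.- i) 0)) (ℚᵘ.≃-sym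
    (ℚᵘ.≃-trans (ℚ.toℚᵘ-homo‿- (fromℤ i)) (ℚᵘ.-‿cong (ℚ.toℚᵘ-fromℚᵘ (mkℚᵘ i 0))))))

  /-*-cancel : ∀ i d → (i ℚ./ suc d) * fromℤ (+ suc d) ≡ fromℤ i
  /-*-cancel i d = trans (sym (fromℚᵘ-homo-* (mkℚᵘ i d) (mkℚᵘ (+ suc d) 0)))
    (ℚ.fromℚᵘ-cong {mkℚᵘ i d ℚᵘ.* mkℚᵘ (+ suc d) 0} {mkℚᵘ i 0}
      (*≡* (ℤ.*-assoc i (+ suc d) (+ 1))))

  fromℕ : ℕ → ℚ
  fromℕ t = fromℤ (+ t)

  fromℕ-* : ∀ m n → fromℕ (m ℕ.* n) ≡ fromℕ m * fromℕ n
  fromℕ-* m n = trans (cong fromℤ (ℤ.pos-* m n)) (fromℤ-* (+ m) (+ n))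

  fromℕ-mono-< : ∀ {m n} → m ℕ.< n → fromℕ m ℚ.< fromℕ n
  fromℕ-mono-< {m} {n} m<n = ℚ.toℚᵘ-cancel-< (ℚᵘ.<-respˡ-≃ (ℚᵘ.≃-sym (ℚ.toℚᵘ-fromℚᵘ (mkℚᵘ (+ m) 0)))
    (ℚᵘ.<-respʳ-≃ (ℚᵘ.≃-sym (ℚ.toℚᵘ-fromℚᵘ (mkℚᵘ (+ n) 0)))
      (ℚᵘ.*<* (ℤ.*-monoʳ-<-pos (+ 1) (ℤ.+<+ m<n)))))

  -- Circle points and orientation determinants.

  denom : ℕ → ℚ
  denom t = 1ℚ + fromℕ t * fromℕ t

  fromℕ-1+t² : ∀ t → fromℕ (suc (t ℕ.* t)) ≡ denom t
  fromℕ-1+t² t = trans (fromℤ-+ (+ 1) (+ (t ℕ.* t))) (cong (λ z → 1ℚ + z) (fromℕ-* t t))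

  -- Clearing the denominator replaces the normalised fraction by a polynomial in t, the form in
  -- which the ring solver can use it.
  abscissa-eq : ∀ t → proj₁ (circlePoint t) * denom t ≡ fromℕ t + fromℕ t
  abscissa-eq t = trans (cong (proj₁ (circlePoint t) *_) (sym (fromℕ-1+t² t)))
    (trans (/-*-cancel (+ (2 ℕ.* t)) (t ℕ.* t))
    (trans (fromℕ-* 2 t) (solve 1 (λ x → con (fromℕ 2) :* x := x :+ x) refl (fromℕ t))))

  ordinate-eq : ∀ t → proj₂ (circlePoint t) * denom t ≡ 1ℚ - fromℕ t * fromℕ t
  ordinate-eq t = trans (cong (proj₂ (circlePoint t) *_) (sym (fromℕ-1+t² t)))
    (trans (/-*-cancel (1 ℤ.⊖ t ℕ.* t) (t ℕ.* t))
    (trans (cong fromℤ (sym (ℤ.m-n≡m⊖n 1 (t ℕ.* t))))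
    (trans (fromℤ-+ (+ 1) (ℤ.- (+ (t ℕ.* t))))
    (cong (λ z → 1ℚ + z) (trans (fromℤ-neg (+ (t ℕ.* t))) (cong -_ (fromℕ-* t t)))))))

  -- Twice the area of the triangle, signed so that clockwise is positive, because `circlePoint`
  -- runs clockwise.
  det : Point → Point → Point → ℚ
  det (px , py) (qx , qy) (x , y) = (qy - py) * (x - px) - (qx - px) * (y - py)

  -- Scaling each point by its denominator turns the determinant into one with rows 1 + t², 2t, 1 -
  -- t². The change of basis from 1, t, t² has determinant of absolute value 4; what remains is
  -- Vandermonde.
  det-circle : ∀ a b c →
    det (circlePoint a) (circlePoint b) (circlePoint c) * (denom a * denom b * denom c)
    ≡ fromℕ 4 * ((fromℕ b - fromℕ a) * (fromℕ c - fromℕ a) * (fromℕ c - fromℕ b))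
  det-circle a b c = trans
    (solve 9 (λ xa ya da xb yb db xc yc dc →
       ((yb :- ya) :* (xc :- xa) :- (xb :- xa) :* (yc :- ya)) :* (da :* db :* dc)
       := da :* ((yb :* db) :* (xc :* dc) :- (xb :* db) :* (yc :* dc))
          :+ db :* ((xa :* da) :* (yc :* dc) :- (ya :* da) :* (xc :* dc))
          :+ dc :* ((xb :* db) :* (ya :* da) :- (yb :* db) :* (xa :* da)))
     refl (proj₁ (circlePoint a)) (proj₂ (circlePoint a)) (denom a)
          (proj₁ (circlePoint b)) (proj₂ (circlePoint b)) (denom b)
          (proj₁ (circlePoint c)) (proj₂ (circlePoint c)) (denom c))
    (trans (subst-eqs (abscissa-eq a) (ordinate-eq a) (abscissa-eq b) (ordinate-eq b) (abscissa-eq c) (ordinate-eq c))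
    (solve 3 (λ a b c →
       (con 1ℚ :+ a :* a) :* ((con 1ℚ :- b :* b) :* (c :+ c) :- (b :+ b) :* (con 1ℚ :- c :* c))
       :+ (con 1ℚ :+ b :* b) :* ((a :+ a) :* (con 1ℚ :- c :* c) :- (con 1ℚ :- a :* a) :* (c :+ c))
       :+ (con 1ℚ :+ c :* c) :* ((b :+ b) :* (con 1ℚ :- a :* a) :- (con 1ℚ :- b :* b) :* (a :+ a))
       := con (fromℕ 4) :* ((b :- a) :* (c :- a) :* (c :- b)))
     refl (fromℕ a) (fromℕ b) (fromℕ c)))
    where
    subst-eqs : ∀ {xa xa′ ya ya′ xb xb′ yb yb′ xc xc′ yc yc′} →
      xa ≡ xa′ → ya ≡ ya′ → xb ≡ xb′ → yb ≡ yb′ → xc ≡ xc′ → yc ≡ yc′ →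
      denom a * (yb * xc - xb * yc) + denom b * (xa * yc - ya * xc) + denom c * (xb * ya - yb * xa)
      ≡ denom a * (yb′ * xc′ - xb′ * yc′) + denom b * (xa′ * yc′ - ya′ * xc′) + denom c * (xb′ * ya′ - yb′ * xa′)
    subst-eqs refl refl refl refl refl refl = refl

  -- Inequalities in the ordered field ℚ.

  <⇒≱ : ∀ {p q} → p ℚ.< q → ¬ q ℚ.≤ p
  <⇒≱ p<q q≤p = ℚ.<-irrefl refl (ℚ.<-≤-trans p<q q≤p)

  0<+ : ∀ {p q} → 0ℚ ℚ.< p → 0ℚ ℚ.≤ q → 0ℚ ℚ.< p + q
  0<+ = ℚ.+-mono-<-≤

  0≤+ : ∀ {p q} → 0ℚ ℚ.≤ p → 0ℚ ℚ.≤ q → 0ℚ ℚ.≤ p + q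
  0≤+ = ℚ.+-mono-≤

  0<* : ∀ {p q} → 0ℚ ℚ.< p → 0ℚ ℚ.< q → 0ℚ ℚ.< p * q
  0<* {p} {q} 0<p 0<q = ℚ.positive⁻¹ (p * q) {{ℚ.pos*pos⇒pos p {{ℚ.positive 0<p}} q {{ℚ.positive 0<q}}}}

  0≤* : ∀ {p q} → 0ℚ ℚ.≤ p → 0ℚ ℚ.≤ q → 0ℚ ℚ.≤ p * q
  0≤* {p} {q} 0≤p 0≤q = ℚ.nonNegative⁻¹ (p * q)
    {{ℚ.nonNeg*nonNeg⇒nonNeg p {{ℚ.nonNegative 0≤p}} q {{ℚ.nonNegative 0≤q}}}}

  <⇒0<- : ∀ {p q} → p ℚ.< q → 0ℚ ℚ.< q - p
  <⇒0<- {p} {q} p<q = subst (ℚ._< q - p) (ℚ.+-inverseʳ p) (ℚ.+-monoˡ-< (- p) p<q)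

  ≤⇒0≤- : ∀ {p q} → p ℚ.≤ q → 0ℚ ℚ.≤ q - p
  ≤⇒0≤- {p} {q} p≤q = subst (ℚ._≤ q - p) (ℚ.+-inverseʳ p) (ℚ.+-monoˡ-≤ (- p) p≤q)

  0<-⇒< : ∀ {p q} → 0ℚ ℚ.< q - p → p ℚ.< q
  0<-⇒< {p} {q} 0<d = subst₂ ℚ._<_ (ℚ.+-identityˡ p)
    (solve 2 (λ p q → q :- p :+ p := q) refl p q) (ℚ.+-monoˡ-< p 0<d)

  0≤-⇒≤ : ∀ {p q} → 0ℚ ℚ.≤ q - p → p ℚ.≤ q
  0≤-⇒≤ {p} {q} 0≤d = subst₂ ℚ._≤_ (ℚ.+-identityˡ p)
    (solve 2 (λ p q → q :- p :+ p := q) refl p q) (ℚ.+-monoˡ-≤ p 0≤d)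

  0<*-cancelʳ : ∀ {p r} → 0ℚ ℚ.< r → 0ℚ ℚ.< p * r → 0ℚ ℚ.< p
  0<*-cancelʳ {p} {r} 0<r 0<pr = ℚ.*-cancelʳ-<-nonNeg r {{ℚ.nonNegative (ℚ.<⇒≤ 0<r)}}
    (subst (ℚ._< p * r) (sym (ℚ.*-zeroˡ r)) 0<pr)

  0≤*-cancelʳ : ∀ {p r} → 0ℚ ℚ.< r → 0ℚ ℚ.≤ p * r → 0ℚ ℚ.≤ p
  0≤*-cancelʳ {p} {r} 0<r 0≤pr = ℚ.*-cancelʳ-≤-pos r {{ℚ.positive 0<r}}
    (subst (ℚ._≤ p * r) (sym (ℚ.*-zeroˡ r)) 0≤pr)

  *-cancelʳ-≡ : ∀ {p q r} → 0ℚ ℚ.< r → p * r ≡ q * r → p ≡ q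
  *-cancelʳ-≡ {p} {q} {r} 0<r eq = ℚ.≤-antisym
    (ℚ.*-cancelʳ-≤-pos r {{ℚ.positive 0<r}} (ℚ.≤-reflexive eq))
    (ℚ.*-cancelʳ-≤-pos r {{ℚ.positive 0<r}} (ℚ.≤-reflexive (sym eq)))

  0≤x² : ∀ x → 0ℚ ℚ.≤ x * x
  0≤x² x with ℚ.≤-total 0ℚ x
  ... | inj₁ 0≤x = 0≤* 0≤x 0≤x
  ... | inj₂ x≤0 = subst (0ℚ ℚ.≤_) (solve 1 (λ x → (con 0ℚ :- x) :* (con 0ℚ :- x) := x :* x) refl x)
                     (0≤* (≤⇒0≤- x≤0) (≤⇒0≤- x≤0))

  0<x² : ∀ {x} → x ≢ 0ℚ → 0ℚ ℚ.< x * x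
  0<x² {x} x≢0 with ℚ.<-cmp 0ℚ x
  ... | tri< 0<x _ _ = 0<* 0<x 0<x
  ... | tri≈ _ 0≡x _ = contradiction (sym 0≡x) x≢0
  ... | tri> _ _ x<0 = subst (0ℚ ℚ.<_) (solve 1 (λ x → (con 0ℚ :- x) :* (con 0ℚ :- x) := x :* x) refl x)
                     (0<* (<⇒0<- x<0) (<⇒0<- x<0))

  -- Quotients enter only through the equation `p * r ≡ q`, so that later identities remain
  -- polynomial.
  divide : ∀ {r} → 0ℚ ℚ.< r → ∀ q → ∃[ p ] p * r ≡ q
  divide {r} 0<r q = q * 1/ r , (begin
    q * 1/ r * r    ≡⟨ ℚ.*-assoc q (1/ r) r ⟩
    q * (1/ r * r)  ≡⟨ cong (q *_) (ℚ.*-inverseˡ r) ⟩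
    q * 1ℚ          ≡⟨ ℚ.*-identityʳ q ⟩
    q               ∎)
    where
    open ≡-Reasoning
    instance _ = ℚ.pos⇒nonZero r {{ℚ.positive 0<r}}

  0<denom : ∀ t → 0ℚ ℚ.< denom t
  0<denom t = 0<+ (ℚ.positive⁻¹ 1ℚ) (0≤x² (fromℕ t))

  det-increasing : ∀ {a b c} → a ℕ.< b → b ℕ.< c →
    0ℚ ℚ.< det (circlePoint a) (circlePoint b) (circlePoint c)
  det-increasing {a} {b} {c} a<b b<c =
    0<*-cancelʳ (0<* (0<* (0<denom a) (0<denom b)) (0<denom c))
      (subst (0ℚ ℚ.<_) (sym (det-circle a b c))
        (0<* {fromℕ 4} (ℚ.positive⁻¹ _)
          (0<* (0<* (diff a<b) (diff (ℕ.<-trans a<b b<c))) (diff b<c))))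
    where
    diff : ∀ {m n} → m ℕ.< n → 0ℚ ℚ.< fromℕ n - fromℕ m
    diff m<n = <⇒0<- (fromℕ-mono-< m<n)

  det-rotate : ∀ P Q R → det P Q R ≡ det Q R P
  det-rotate (px , py) (qx , qy) (rx , ry) =
    solve 6 (λ px py qx qy rx ry →
      (qy :- py) :* (rx :- px) :- (qx :- px) :* (ry :- py)
      := (ry :- qy) :* (px :- qx) :- (rx :- qx) :* (py :- qy)) refl px py qx qy rx ry

  det-swap : ∀ P Q R → det Q P R ≡ 0ℚ - det P Q R
  det-swap (px , py) (qx , qy) (rx , ry) =
    solve 6 (λ px py qx qy rx ry →
      (py :- qy) :* (rx :- qx) :- (px :- qx) :* (ry :- qy)
      := con 0ℚ :- ((qy :- py) :* (rx :- px) :- (qx :- px) :* (ry :- py))) refl px py qx qy rx ry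

  det-along : ∀ P Q z w s → det P Q (along z w s) ≡ det P Q z + s * (det P Q w - det P Q z)
  det-along (px , py) (qx , qy) (x , y) (x′ , y′) s =
    solve 9 (λ px py qx qy x y x′ y′ s →
      (qy :- py) :* (x :+ s :* (x′ :- x) :- px) :- (qx :- px) :* (y :+ s :* (y′ :- y) :- py)
      := ((qy :- py) :* (x :- px) :- (qx :- px) :* (y :- py))
         :+ s :* (((qy :- py) :* (x′ :- px) :- (qx :- px) :* (y′ :- py))
                  :- ((qy :- py) :* (x :- px) :- (qx :- px) :* (y :- py))))
      refl px py qx qy x y x′ y′ s

  det-on-line : ∀ P Q s → det P Q (along P Q s) ≡ 0ℚ
  det-on-line (px , py) (qx , qy) s =
    solve 5 (λ px py qx qy s →
      (qy :- py) :* (px :+ s :* (qx :- px) :- px) :- (qx :- px) :* (py :+ s :* (qy :- py) :- py)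
      := con 0ℚ) refl px py qx qy s

  -- The unit disc and its chords.

  ∣_∣² : Point → ℚ
  ∣ x , y ∣² = x * x + y * y

  distance² : Point → Point → ℚ
  distance² (x , y) (x′ , y′) = (x′ - x) * (x′ - x) + (y′ - y) * (y′ - y)

  -- The Pythagorean identity (2T)² + (1 - T²)² = (1 + T²)², compared after multiplying by (1 +
  -- T²)².
  norm-of-parametrisation : ∀ x y T → 0ℚ ℚ.< 1ℚ + T * T →
    x * (1ℚ + T * T) ≡ T + T → y * (1ℚ + T * T) ≡ 1ℚ - T * T → ∣ x , y ∣² ≡ 1ℚ
  norm-of-parametrisation x y T 0<d x-eq y-eq = *-cancelʳ-≡ (0<* 0<d 0<d) (begin
    (x * x + y * y) * (d * d)
      ≡⟨ solve 3 (λ x y d → (x :* x :+ y :* y) :* (d :* d) := (x :* d) :* (x :* d) :+ (y :* d) :* (y :* d))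
           refl x y d ⟩
    (x * d) * (x * d) + (y * d) * (y * d)
      ≡⟨ cong₂ (λ u v → u * u + v * v) x-eq y-eq ⟩
    (T + T) * (T + T) + (1ℚ - T * T) * (1ℚ - T * T)
      ≡⟨ solve 1 (λ T → (T :+ T) :* (T :+ T) :+ (con 1ℚ :- T :* T) :* (con 1ℚ :- T :* T)
           := con 1ℚ :* ((con 1ℚ :+ T :* T) :* (con 1ℚ :+ T :* T))) refl T ⟩
    1ℚ * (d * d) ∎)
    where
    open ≡-Reasoning
    d = 1ℚ + T * T

  norm-circlePoint : ∀ t → ∣ circlePoint t ∣² ≡ 1ℚ
  norm-circlePoint t = norm-of-parametrisation (proj₁ (circlePoint t)) (proj₂ (circlePoint t)) (fromℕ t)
    (0<denom t) (abscissa-eq t) (ordinate-eq t)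

  -- The power of a point with respect to the unit circle. It is read in both directions: chords lie
  -- in the disc, and a point of the line that is in the disc lies on the chord.
  norm-along : ∀ P Q s → ∣ P ∣² ≡ 1ℚ → ∣ Q ∣² ≡ 1ℚ →
    1ℚ - ∣ along P Q s ∣² ≡ s * (1ℚ - s) * distance² P Q
  norm-along P@(px , py) Q@(qx , qy) s ∣P∣ ∣Q∣ = trans
    (solve 5 (λ px py qx qy s →
      con 1ℚ :- ((px :+ s :* (qx :- px)) :* (px :+ s :* (qx :- px))
                 :+ (py :+ s :* (qy :- py)) :* (py :+ s :* (qy :- py)))
      := s :* (con 1ℚ :- s) :* ((qx :- px) :* (qx :- px) :+ (qy :- py) :* (qy :- py))
         :+ (con 1ℚ :- (con 1ℚ :- s) :* (px :* px :+ py :* py) :- s :* (qx :* qx :+ qy :* qy)))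
      refl px py qx qy s)
    (collect (s * (1ℚ - s) * distance² P Q) ∣ P ∣² ∣ Q ∣² ∣P∣ ∣Q∣)
    where
    collect : ∀ e p q → p ≡ 1ℚ → q ≡ 1ℚ → e + (1ℚ - (1ℚ - s) * p - s * q) ≡ e
    collect e p q refl refl =
      solve 2 (λ e s → e :+ (con 1ℚ :- (con 1ℚ :- s) :* con 1ℚ :- s :* con 1ℚ) := e) refl e s

  0≤distance² : ∀ P Q → 0ℚ ℚ.≤ distance² P Q
  0≤distance² (px , py) (qx , qy) = 0≤+ (0≤x² (qx - px)) (0≤x² (qy - py))

  chord-inDisc : ∀ P Q s → ∣ P ∣² ≡ 1ℚ → ∣ Q ∣² ≡ 1ℚ → 0ℚ ℚ.≤ s → s ℚ.≤ 1ℚ → InDisc (along P Q s)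
  chord-inDisc P Q s ∣P∣ ∣Q∣ 0≤s s≤1 = 0≤-⇒≤
    (subst (0ℚ ℚ.≤_) (sym (norm-along P Q s ∣P∣ ∣Q∣)) (0≤* (0≤* 0≤s (≤⇒0≤- s≤1)) (0≤distance² P Q)))

  0≤s[1-s]⇒s∈[0,1] : ∀ s → 0ℚ ℚ.≤ s * (1ℚ - s) → 0ℚ ℚ.≤ s × s ℚ.≤ 1ℚ
  0≤s[1-s]⇒s∈[0,1] s h with 0ℚ ℚ.≤? s | s ℚ.≤? 1ℚ
  ... | yes 0≤s | yes s≤1 = 0≤s , s≤1
  ... | no 0≰s  | _       = contradiction h (<⇒≱ (0<-⇒< (subst (0ℚ ℚ.<_)
          (solve 1 (λ s → (con 0ℚ :- s) :* (con 1ℚ :- s) := con 0ℚ :- s :* (con 1ℚ :- s)) refl s)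
          (0<* (<⇒0<- s<0) (<⇒0<- (ℚ.<-trans s<0 (ℚ.positive⁻¹ 1ℚ)))))))
    where s<0 = ℚ.≰⇒> 0≰s
  ... | yes _   | no s≰1  = contradiction h (<⇒≱ (0<-⇒< (subst (0ℚ ℚ.<_)
          (solve 1 (λ s → s :* (s :- con 1ℚ) := con 0ℚ :- s :* (con 1ℚ :- s)) refl s)
          (0<* (ℚ.<-trans (ℚ.positive⁻¹ 1ℚ) 1<s) (<⇒0<- 1<s)))))
    where 1<s = ℚ.≰⇒> s≰1

  det>0⇒distinct : ∀ P Q R → 0ℚ ℚ.< det P Q R → 0ℚ ℚ.< distance² P Q
  det>0⇒distinct (px , py) (qx , qy) (x , y) = distinct (qx - px) (qy - py) (x - px) (y - py)
    where
    distinct : ∀ ex ey u v → 0ℚ ℚ.< ey * u - ex * v → 0ℚ ℚ.< ex * ex + ey * ey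
    distinct ex ey u v 0<det with ex ℚ.≟ 0ℚ | ey ℚ.≟ 0ℚ
    ... | no ex≢0  | _        = 0<+ (0<x² ex≢0) (0≤x² ey)
    ... | yes _    | no ey≢0  = ℚ.+-mono-≤-< (0≤x² ex) (0<x² ey≢0)
    ... | yes refl | yes refl = contradiction
            (solve 2 (λ a b → con 0ℚ := con 0ℚ :* a :- con 0ℚ :* b) refl u v) (ℚ.<⇒≢ 0<det)

  -- With e = Q - P and u = z - P, the vector |e|² u is (u · e) e plus a multiple of the determinant
  -- perpendicular to e. The determinant vanishes, so z has parameter s = (u · e) / |e|².
  on-line-x : ∀ x px ex ey v s → s * (ex * ex + ey * ey) ≡ (x - px) * ex + v * ey →
    ey * (x - px) - ex * v ≡ 0ℚ → x * (ex * ex + ey * ey) ≡ (px + s * ex) * (ex * ex + ey * ey)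
  on-line-x x px ex ey v s s*e≡ det≡0 = trans
    (solve 5 (λ x px ex ey v →
      x :* (ex :* ex :+ ey :* ey) := px :* (ex :* ex :+ ey :* ey)
        :+ ((x :- px) :* ex :+ v :* ey) :* ex :+ (ey :* (x :- px) :- ex :* v) :* ey)
      refl x px ex ey v)
    (trans (cong₂ (λ a b → px * (ex * ex + ey * ey) + a * ex + b * ey) (sym s*e≡) det≡0)
    (solve 5 (λ px e s ex ey → px :* e :+ s :* e :* ex :+ con 0ℚ :* ey := (px :+ s :* ex) :* e)
      refl px (ex * ex + ey * ey) s ex ey))

  on-line-y : ∀ y py ex ey u s → s * (ex * ex + ey * ey) ≡ u * ex + (y - py) * ey →
    ey * u - ex * (y - py) ≡ 0ℚ → y * (ex * ex + ey * ey) ≡ (py + s * ey) * (ex * ex + ey * ey)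
  on-line-y y py ex ey u s s*e≡ det≡0 = trans
    (solve 5 (λ y py ex ey u →
      y :* (ex :* ex :+ ey :* ey) := py :* (ex :* ex :+ ey :* ey)
        :+ (u :* ex :+ (y :- py) :* ey) :* ey :- (ey :* u :- ex :* (y :- py)) :* ex)
      refl y py ex ey u)
    (trans (cong₂ (λ a b → py * (ex * ex + ey * ey) + a * ey - b * ex) (sym s*e≡) det≡0)
    (solve 5 (λ py e s ex ey → py :* e :+ s :* e :* ey :- con 0ℚ :* ex := (py :+ s :* ey) :* e)
      refl py (ex * ex + ey * ey) s ex ey))

  on-line : ∀ P Q z → 0ℚ ℚ.< distance² P Q → det P Q z ≡ 0ℚ → ∃[ s ] z ≡ along P Q s
  on-line (px , py) (qx , qy) (x , y) 0<e det≡0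
    with divide 0<e ((x - px) * (qx - px) + (y - py) * (qy - py))
  ... | s , s*e≡ = s , cong₂ _,_
    (*-cancelʳ-≡ 0<e (on-line-x x px (qx - px) (qy - py) (y - py) s s*e≡ det≡0))
    (*-cancelʳ-≡ 0<e (on-line-y y py (qx - px) (qy - py) (x - px) s s*e≡ det≡0))

  -- By the power of a point, z in the disc means 0 ≤ s (1 - s) |PQ|², which confines s to [0, 1].
  in-chord : ∀ P Q z → ∣ P ∣² ≡ 1ℚ → ∣ Q ∣² ≡ 1ℚ → 0ℚ ℚ.< distance² P Q → InDisc z → det P Q z ≡ 0ℚ →
    ∃[ s ] (0ℚ ℚ.≤ s × s ℚ.≤ 1ℚ) × z ≡ along P Q s
  in-chord P Q z ∣P∣ ∣Q∣ 0<e z∈disc det≡0 = s , 0≤s[1-s]⇒s∈[0,1] s 0≤s[1-s] , z≡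
    where
    s = proj₁ (on-line P Q z 0<e det≡0)
    z≡ : z ≡ along P Q s
    z≡ = proj₂ (on-line P Q z 0<e det≡0)
    0≤s[1-s] : 0ℚ ℚ.≤ s * (1ℚ - s)
    0≤s[1-s] = 0≤*-cancelʳ 0<e (subst (0ℚ ℚ.≤_) (norm-along P Q s ∣P∣ ∣Q∣)
      (≤⇒0≤- (subst InDisc z≡ z∈disc)))

  -- Hulls as weighted averages.

  sum-cong : ∀ {f g : ℕ → ℚ} → (∀ r → f r ≡ g r) → ∀ L → sumℚ (map f L) ≡ sumℚ (map g L)
  sum-cong f≗g []      = refl
  sum-cong f≗g (r ∷ L) = cong₂ _+_ (f≗g r) (sum-cong f≗g L)

  sum-linear : ∀ α β (f g : ℕ → ℚ) L →
    sumℚ (map (λ r → α * f r + β * g r) L) ≡ α * sumℚ (map f L) + β * sumℚ (map g L)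
  sum-linear α β f g []      = solve 2 (λ α β → con 0ℚ := α :* con 0ℚ :+ β :* con 0ℚ) refl α β
  sum-linear α β f g (r ∷ L) = trans (cong (λ u → α * f r + β * g r + u) (sum-linear α β f g L))
    (solve 6 (λ α β a b c d → α :* a :+ β :* b :+ (α :* c :+ β :* d) := α :* (a :+ c) :+ β :* (b :+ d))
      refl α β (f r) (g r) (sumℚ (map f L)) (sumℚ (map g L)))

  indicator : Bool → ℚ
  indicator c = if c then 1ℚ else 0ℚ

  δ : ℕ → ℕ → ℚ
  δ p r = indicator (does (p ℕ.≟ r))

  δ-≡ : ∀ p → δ p p ≡ 1ℚ
  δ-≡ p = cong indicator (dec-true (p ℕ.≟ p) refl)

  δ-≢ : ∀ {p r} → p ≢ r → δ p r ≡ 0ℚ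
  δ-≢ {p} {r} p≢r = cong indicator (dec-false (p ℕ.≟ r) p≢r)

  0≤indicator : ∀ c → 0ℚ ℚ.≤ indicator c
  0≤indicator true  = ℚ.nonNegative⁻¹ 1ℚ
  0≤indicator false = ℚ.≤-refl

  0≤δ : ∀ p r → 0ℚ ℚ.≤ δ p r
  0≤δ p r = 0≤indicator (does (p ℕ.≟ r))

  sum-δ-∉ : ∀ {p} (g : ℕ → ℚ) {L} → p ∉ L → sumℚ (map (λ r → δ p r * g r) L) ≡ 0ℚ
  sum-δ-∉ g {[]}    p∉L = refl
  sum-δ-∉ g {r ∷ L} p∉L = cong₂ _+_
    (trans (cong (_* g r) (δ-≢ (λ p≡r → p∉L (here p≡r)))) (ℚ.*-zeroˡ (g r)))
    (sum-δ-∉ g (λ p∈L → p∉L (there p∈L)))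

  sum-δ : ∀ {p} (g : ℕ → ℚ) {L} → Unique L → p ∈ L → sumℚ (map (λ r → δ p r * g r) L) ≡ g p
  sum-δ {p} g {_ ∷ L} (p∉L ∷ _) (here refl) = trans
    (cong₂ _+_ (trans (cong (_* g p) (δ-≡ p)) (ℚ.*-identityˡ (g p))) (sum-δ-∉ g (All¬⇒¬Any p∉L)))
    (ℚ.+-identityʳ (g p))
  sum-δ {p} g {r ∷ L} (r∉L ∷ L!) (there p∈L) = trans
    (cong₂ _+_ (trans (cong (_* g r) (δ-≢ (λ p≡r → All¬⇒¬Any r∉L (subst (_∈ L) p≡r p∈L)))) (ℚ.*-zeroˡ (g r)))
      (sum-δ g L! p∈L))
    (ℚ.+-identityˡ (g p))

  -- Weights are functions of the label summed along the block, so distinct letters are what makes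
  -- each δ contribute exactly once. For p = q the two contributions add up.
  chord⊆hull : ∀ b {p q s} → Unique (letters b) → p ∈ letters b → q ∈ letters b → 0ℚ ℚ.≤ s → s ℚ.≤ 1ℚ →
    InHull b (along (unprimed p) (unprimed q) s)
  chord⊆hull b {p} {q} {s} b! p∈b q∈b 0≤s s≤1 = record
    { weight      = weight
    ; nonNegative = All.universal (λ r → 0≤+ (0≤* (≤⇒0≤- s≤1) (0≤δ p r)) (0≤* 0≤s (0≤δ q r))) (letters b)
    ; total       = trans (sum-cong (λ r → sym (ℚ.*-identityʳ (weight r))) (letters b))
                      (trans (weighted (λ _ → 1ℚ))
                        (solve 1 (λ s → con 1ℚ :+ s :* (con 1ℚ :- con 1ℚ) := con 1ℚ) refl s))
    ; abscissa    = weighted (λ r → proj₁ (unprimed r))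
    ; ordinate    = weighted (λ r → proj₂ (unprimed r))
    }
    where
    weight : ℕ → ℚ
    weight r = (1ℚ - s) * δ p r + s * δ q r

    -- One computation for all three sums: g is the constant 1, the abscissa or the ordinate.
    weighted : ∀ (g : ℕ → ℚ) → sumℚ (map (λ r → weight r * g r) (letters b)) ≡ g p + s * (g q - g p)
    weighted g = trans
      (sum-cong (λ r → solve 4 (λ s a b c → ((con 1ℚ :- s) :* a :+ s :* b) :* c
                    := (con 1ℚ :- s) :* (a :* c) :+ s :* (b :* c)) refl s (δ p r) (δ q r) (g r)) (letters b))
      (trans (sum-linear (1ℚ - s) s (λ r → δ p r * g r) (λ r → δ q r * g r) (letters b))
      (trans (cong₂ (λ u v → (1ℚ - s) * u + s * v) (sum-δ g b! p∈b) (sum-δ g b! q∈b))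
        (solve 3 (λ s a b → (con 1ℚ :- s) :* a :+ s :* b := a :+ s :* (b :- a)) refl s (g p) (g q))))

  sum-nonneg : ∀ {w f : ℕ → ℚ} {L} → All (λ r → 0ℚ ℚ.≤ w r) L → All (λ r → 0ℚ ℚ.< f r) L →
    0ℚ ℚ.≤ sumℚ (map (λ r → w r * f r) L)
  sum-nonneg []          []          = ℚ.≤-refl
  sum-nonneg (0≤w ∷ 0≤ws) (0<f ∷ 0<fs) = 0≤+ (0≤* 0≤w (ℚ.<⇒≤ 0<f)) (sum-nonneg 0≤ws 0<fs)

  -- Single weights may vanish, but a positive total leaves some weight positive; the others
  -- contribute nonnegative terms.
  sum-pos : ∀ {w f : ℕ → ℚ} {L} → All (λ r → 0ℚ ℚ.≤ w r) L → All (λ r → 0ℚ ℚ.< f r) L →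
    0ℚ ℚ.< sumℚ (map w L) → 0ℚ ℚ.< sumℚ (map (λ r → w r * f r) L)
  sum-pos [] [] 0<0 = 0<0
  sum-pos {w} {f} {r ∷ L} (0≤w ∷ 0≤ws) (0<f ∷ 0<fs) 0<sum with 0ℚ ℚ.<? w r
  ... | yes 0<w = 0<+ (0<* 0<w 0<f) (sum-nonneg 0≤ws 0<fs)
  ... | no  0≮w = ℚ.+-mono-≤-< (0≤* 0≤w (ℚ.<⇒≤ 0<f)) (sum-pos 0≤ws 0<fs
        (subst (0ℚ ℚ.<_) (trans (cong (_+ sumℚ (map w L)) (ℚ.≤-antisym (ℚ.≮⇒≥ 0≮w) 0≤w))
          (ℚ.+-identityˡ _)) 0<sum))

  -- Convexity of the open half-plane: `det P Q` is affine and the weights total 1, so its value at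
  -- z is the weighted average of its values at the vertices.
  hull-positive : ∀ P Q b z → All (λ p → 0ℚ ℚ.< det P Q (unprimed p)) (letters b) → InHull b z →
    0ℚ ℚ.< det P Q z
  hull-positive (px , py) (qx , qy) b (x , y) 0<det h = subst (0ℚ ℚ.<_) sum-det
    (sum-pos nonNegative 0<det (subst (0ℚ ℚ.<_) (sym total) (ℚ.positive⁻¹ 1ℚ)))
    where
    open InHull h
    ex = qx - px
    ey = qy - py
    -- The constant term of the affine function: det at (x , y) is ey x - ex y - c.
    c = px * ey - py * ex
    ux uy : ℕ → ℚ
    ux r = proj₁ (unprimed r)
    uy r = proj₂ (unprimed r)
    expand : ∀ ex ey w x y →
      w * (ey * (x - px) - ex * (y - py)) ≡ 1ℚ * (ey * (w * x) + (- ex) * (w * y)) + (- (px * ey - py * ex)) * w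
    expand ex ey w x y = solve 7 (λ px py ex ey w x y →
      w :* (ey :* (x :- px) :- ex :* (y :- py))
      := con 1ℚ :* (ey :* (w :* x) :+ (+-*-Solver.:- ex) :* (w :* y)) :+ (+-*-Solver.:- (px :* ey :- py :* ex)) :* w)
      refl px py ex ey w x y
    sum-det : sumℚ (map (λ r → weight r * det (px , py) (qx , qy) (unprimed r)) (letters b))
              ≡ det (px , py) (qx , qy) (x , y)
    sum-det = begin
      sumℚ (map (λ r → weight r * det (px , py) (qx , qy) (unprimed r)) (letters b))
        ≡⟨ sum-cong (λ r → expand ex ey (weight r) (ux r) (uy r)) (letters b) ⟩
      sumℚ (map (λ r → 1ℚ * (ey * (weight r * ux r) + (- ex) * (weight r * uy r)) + (- c) * weight r) (letters b))
        ≡⟨ sum-linear 1ℚ (- c) (λ r → ey * (weight r * ux r) + (- ex) * (weight r * uy r)) weight (letters b) ⟩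
      1ℚ * sumℚ (map (λ r → ey * (weight r * ux r) + (- ex) * (weight r * uy r)) (letters b)) + (- c) * sumℚ (map weight (letters b))
        ≡⟨ cong₂ (λ u v → 1ℚ * u + (- c) * v)
             (trans (sum-linear ey (- ex) (λ r → weight r * ux r) (λ r → weight r * uy r) (letters b))
               (cong₂ (λ u v → ey * u + (- ex) * v) abscissa ordinate)) total ⟩
      1ℚ * (ey * x + (- ex) * y) + (- c) * 1ℚ
        ≡⟨ solve 6 (λ px py ex ey x y →
             con 1ℚ :* (ey :* x :+ (+-*-Solver.:- ex) :* y) :+ (+-*-Solver.:- (px :* ey :- py :* ex)) :* con 1ℚ
             := ey :* (x :- px) :- ex :* (y :- py)) refl px py ex ey x y ⟩
      ey * (x - px) - ex * (y - py) ∎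
      where open ≡-Reasoning

  -- Segments and regions of the complement.

  OneSided : Point → Point → Block → Set
  OneSided P Q b = All (λ p → 0ℚ ℚ.< det P Q (unprimed p)) (letters b)
                 ⊎ All (λ p → 0ℚ ℚ.< det Q P (unprimed p)) (letters b)

  along-flip : ∀ P Q s → along P Q s ≡ along Q P (1ℚ - s)
  along-flip (px , py) (qx , qy) s = cong₂ _,_ (flip px qx) (flip py qy)
    where
    flip : ∀ p q → p + s * (q - p) ≡ q + (1ℚ - s) * (p - q)
    flip p q = solve 3 (λ s p q → p :+ s :* (q :- p) := q :+ (con 1ℚ :- s) :* (p :- q)) refl s p q

  -- The determinant is zero along the chord and strictly positive on the hull. The opposite side is
  -- expressed by exchanging the endpoints, so both cases are positivity.
  chord-free : ∀ {π} a b → All (OneSided (circlePoint a) (circlePoint b)) π →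
    SegmentInComplement π (circlePoint a) (circlePoint b)
  chord-free a b sided s 0≤s s≤1 = chord-inDisc P Q s (norm-circlePoint a) (norm-circlePoint b) 0≤s s≤1 , All.map outside sided
    where
    P = circlePoint a
    Q = circlePoint b
    outside : ∀ {B} → OneSided P Q B → ¬ InHull B (along P Q s)
    outside {B} (inj₁ pos) h = ℚ.<⇒≢ (hull-positive P Q B (along P Q s) pos h) (sym (det-on-line P Q s))
    outside {B} (inj₂ pos) h = ℚ.<⇒≢ (hull-positive Q P B (along P Q s) pos h)
      (sym (trans (cong (det Q P) (along-flip P Q s)) (det-on-line Q P (1ℚ - s))))

  segment-reverse : ∀ {π z w} → SegmentInComplement π z w → SegmentInComplement π w z
  segment-reverse {π} {z} {w} free s 0≤s s≤1 = subst (InComplement π) (sym (along-flip w z s))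
    (free (1ℚ - s) (≤⇒0≤- s≤1) (0≤-⇒≤ (subst (0ℚ ℚ.≤_)
      (solve 1 (λ s → s := con 1ℚ :- (con 1ℚ :- s)) refl s) 0≤s)))

  -- An affine function with values dz > 0 and dv ≤ 0 at the ends vanishes at s = dz / (dz - dv), so
  -- the intermediate value is explicit.
  crossing : ∀ P Q z v → 0ℚ ℚ.< det P Q z → det P Q v ℚ.≤ 0ℚ →
    ∃[ s ] 0ℚ ℚ.≤ s × s ℚ.≤ 1ℚ × det P Q (along z v s) ≡ 0ℚ
  crossing P Q z v 0<z v≤0 = cross (det P Q z) (det P Q v) 0<z v≤0 (det-along P Q z v)
    where
    cross : ∀ dz dv → 0ℚ ℚ.< dz → dv ℚ.≤ 0ℚ → (∀ s → det P Q (along z v s) ≡ dz + s * (dv - dz)) →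
      ∃[ s ] 0ℚ ℚ.≤ s × s ℚ.≤ 1ℚ × det P Q (along z v s) ≡ 0ℚ
    cross dz dv 0<dz dv≤0 interpolate = s , 0≤s , s≤1 , det≡0
      where
      d = dz + (0ℚ - dv)
      0<d : 0ℚ ℚ.< d
      0<d = 0<+ 0<dz (≤⇒0≤- dv≤0)
      s = proj₁ (divide 0<d dz)
      s*d≡dz : s * d ≡ dz
      s*d≡dz = proj₂ (divide 0<d dz)
      0≤s : 0ℚ ℚ.≤ s
      0≤s = 0≤*-cancelʳ 0<d (subst (0ℚ ℚ.≤_) (sym s*d≡dz) (ℚ.<⇒≤ 0<dz))
      s≤1 : s ℚ.≤ 1ℚ
      s≤1 = 0≤-⇒≤ (0≤*-cancelʳ 0<d (subst (0ℚ ℚ.≤_)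
        (trans (trans (solve 2 (λ dz dv → con 0ℚ :- dv := (dz :+ (con 0ℚ :- dv)) :- dz) refl dz dv)
          (cong (λ u → d - u) (sym s*d≡dz)))
          (solve 2 (λ s d → d :- s :* d := (con 1ℚ :- s) :* d) refl s d)) (≤⇒0≤- dv≤0)))
      det≡0 : det P Q (along z v s) ≡ 0ℚ
      det≡0 = trans (interpolate s)
        (trans (solve 3 (λ s dz dv → dz :+ s :* (dv :- dz) := dz :- s :* (dz :+ (con 0ℚ :- dv))) refl s dz dv)
        (trans (cong (λ u → dz - u) s*d≡dz) (ℚ.+-inverseʳ dz)))

  -- A segment leaving the side of the chord would meet its line inside the disc, hence the chord itself.
  step-preserved : ∀ {π b} P Q z v → ∣ P ∣² ≡ 1ℚ → ∣ Q ∣² ≡ 1ℚ → b ∈ π →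
    (∀ s → 0ℚ ℚ.≤ s → s ℚ.≤ 1ℚ → InHull b (along P Q s)) →
    SegmentInComplement π z v → 0ℚ ℚ.< det P Q z → 0ℚ ℚ.< det P Q v
  step-preserved {b = b} P Q z v ∣P∣ ∣Q∣ b∈π chord free 0<z = decidable-stable (0ℚ ℚ.<? det P Q v) λ 0≮v →
    let s , 0≤s , s≤1 , det≡0 = crossing P Q z v 0<z (ℚ.≮⇒≥ 0≮v)
        inDisc , outside = free s 0≤s s≤1
        s′ , (0≤s′ , s′≤1) , eq = in-chord P Q (along z v s) ∣P∣ ∣Q∣ (det>0⇒distinct P Q z 0<z) inDisc det≡0
    in All.lookup outside b∈π (subst (InHull b) (sym eq) (chord s′ 0≤s′ s′≤1))

  -- The invariant that keeps regions apart: induction along the path for one fixed chord of one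
  -- hull.
  side-preserved : ∀ {π b p q z w} → b ∈ π → Unique (letters b) → p ∈ letters b → q ∈ letters b →
    SameRegion π z w → 0ℚ ℚ.< det (unprimed p) (unprimed q) z → 0ℚ ℚ.< det (unprimed p) (unprimed q) w
  side-preserved b∈π b! p∈b q∈b ε = id
  side-preserved {b = b} {p} {q} {z} b∈π b! p∈b q∈b (_◅_ {j = v} free path) =
    side-preserved b∈π b! p∈b q∈b path ∘
    step-preserved (unprimed p) (unprimed q) z v (norm-circlePoint (2 ℕ.* p)) (norm-circlePoint (2 ℕ.* q))
      b∈π (λ s → chord⊆hull b b! p∈b q∈b) free

open Geometry using (0<-⇒<; OneSided; chord-free; det; det-increasing; det-rotate; det-swap; segment-reverse; side-preserved)
open import Data.Bool.Base using (if_then_else_)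
open import Data.Empty using (⊥; ⊥-elim)
open import Data.Fin.Base as Fin using (Fin; suc; zero)
open import Data.List.Base using (List; []; _++_; _∷_; foldr; length; lookup; map; reverse)
open import Data.List.Membership.Propositional using (_∈_; find; lose)
open import Data.List.Membership.Propositional.Properties
open import Data.List.Membership.Propositional.Properties.WithK using (unique∧set⇒bag)
open import Data.List.NonEmpty as List⁺ using (List⁺; _∷_; _∷⁺_)
open import Data.List.Properties as List
  using (++-assoc; ++-identityʳ; concatMap-++; unfold-reverse; ∷-injectiveʳ; ∷-injectiveˡ)
open import Data.List.Relation.Binary.BagAndSetEquality using (∼bag⇒↭)
open import Data.List.Relation.Binary.Permutation.Propositional as ↭
  using (_↭_; module PermutationReasoning; prep; ↭-refl; ↭-reflexive; ↭-sym; ↭-trans; ↭⇒↭ₛ)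
open import Data.List.Relation.Binary.Permutation.Propositional.Properties
  using (++-comm; ++⁺; ++⁺ˡ; shift; shifts; ↭-reverse; ∈-resp-↭)
import Data.List.Relation.Binary.Permutation.Setoid.Properties as ↭ₛ
open import Data.List.Relation.Binary.Sublist.Propositional as Sub
  using ([]; _∷_; _∷ʳ_; _⊆_; minimum; ⊆-trans)
import Data.List.Relation.Binary.Sublist.Propositional.Properties as Sublist
open import Data.List.Relation.Unary.All as All using (All; []; _∷_)
import Data.List.Relation.Unary.All.Properties as All
open import Data.List.Relation.Unary.AllPairs as AllPairs using (AllPairs; []; _∷_)
import Data.List.Relation.Unary.AllPairs.Properties as AllPairs
open import Data.List.Relation.Unary.Any as Any using (Any; here; there)
import Data.List.Relation.Unary.Any.Properties as Any
open import Data.List.Relation.Unary.Linked as Linked using (Linked; [-]; []; _∷_)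
open import Data.List.Relation.Unary.Linked.Properties using (AllPairs⇒Linked; Linked⇒AllPairs)
open import Data.List.Relation.Unary.Unique.Propositional using (Unique)
import Data.List.Relation.Unary.Unique.Propositional.Properties as Unique
import Data.List.Sort as Sort
open import Data.Nat.Base using (_*_; _+_; _<_; _>_; _∸_; _≤_; suc; s≤s; zero; z≤n; ℕ)
open import Data.Nat.Properties
open import Data.Product.Base using (_,_; _×_; proj₁; proj₂; uncurry; ∃-syntax)
open import Data.Rational.Base as ℚ using (0ℚ)
import Data.Rational.Properties as ℚ
open import Data.Sum.Base using ([_,_]′; _⊎_; inj₁; inj₂)
open import Data.Tree.Binary using (leaf; module Infix; node)
import Data.Tree.Binary.Relation.Unary.All as Tree
open import Data.Unit.Base using (tt; ⊤)
open import Function.Base using (_∘_; case_of_; flip; id)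
open import Function.Bundles using (_⇔_; mk⇔; module Equivalence)
open import Function.Construct.Composition using (_⇔-∘_)
open import Function.Construct.Symmetry using (⇔-sym)
open import Level using (0ℓ)
open import Relation.Binary.Construct.Closure.ReflexiveTransitive using (_◅_; ε)
open import Relation.Binary.Core using (Rel)
open import Relation.Binary.Definitions using (Asymmetric; Symmetric; Tri; tri<; tri>; tri≈)
open import Relation.Binary.PropositionalEquality
open import Relation.Nullary using (contradiction; no; yes; ¬_)
open import Relation.Nullary.Decidable using (dec-false; dec-true)

-- Sorted lists and enumerations.

sorted-unique : ∀ {A : Set} {R : Rel A 0ℓ} → Asymmetric R → ∀ {xs ys : List A} →
  AllPairs R xs → AllPairs R ys → (∀ {z} → z ∈ xs → z ∈ ys) → (∀ {z} → z ∈ ys → z ∈ xs) → xs ≡ ys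
sorted-unique asym {[]}     {[]}     _ _ _ _ = refl
sorted-unique asym {[]}     {y ∷ ys} _ _ _ ⊇ = case ⊇ (here refl) of λ ()
sorted-unique asym {x ∷ xs} {[]}     _ _ ⊆ _ = case ⊆ (here refl) of λ ()
sorted-unique {R = R} asym {x ∷ xs} {y ∷ ys} (x<xs ∷ xs↗) (y<ys ∷ ys↗) ⊆ ⊇ with x≡y
  where
  x≡y : x ≡ y
  x≡y with ⊆ (here refl) | ⊇ (here refl)
  ... | here eq    | _          = eq
  ... | there _    | here eq    = sym eq
  -- Each head would strictly precede the other.
  ... | there x∈ys | there y∈xs = contradiction (All.lookup x<xs y∈xs) (asym (All.lookup y<ys x∈ys))
... | refl = cong (x ∷_) (sorted-unique asym xs↗ ys↗ (tail x<xs ⊆) (tail y<ys ⊇))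
  where
  tail : ∀ {us vs} → All (R x) us → (∀ {z} → z ∈ x ∷ us → z ∈ x ∷ vs) → ∀ {z} → z ∈ us → z ∈ vs
  tail x<us incl z∈us with incl (there z∈us)
  ... | there z∈vs = z∈vs
  ... | here refl  = contradiction (All.lookup x<us z∈us) (λ p → asym p p)

AllPairs-∷ʳ : ∀ {A : Set} {R : Rel A 0ℓ} {xs : List A} {x} →
  AllPairs R xs → All (λ y → R y x) xs → AllPairs R (xs ++ x ∷ [])
AllPairs-∷ʳ xs↗ xs<x = AllPairs.++⁺ xs↗ ([] ∷ []) (All.map (_∷ []) xs<x)

AllPairs-reverse : ∀ {A : Set} {R : Rel A 0ℓ} {xs : List A} → AllPairs (flip R) xs → AllPairs R (reverse xs)
AllPairs-reverse [] = []
AllPairs-reverse {R = R} {xs = x ∷ xs} (px ∷ pxs) = subst (AllPairs R) (sym (unfold-reverse x xs))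
  (AllPairs-∷ʳ (AllPairs-reverse pxs) (All.tabulate (λ y∈ → All.lookup px (Any-reverse⁻ y∈))))
  where
  open import Data.List.Relation.Unary.Any.Properties using () renaming (reverse⁻ to Any-reverse⁻)

AllPairs-resp-↭ : ∀ {A : Set} {R : Rel A 0ℓ} → Symmetric R → ∀ {xs ys : List A} → xs ↭ ys → AllPairs R xs → AllPairs R ys
AllPairs-resp-↭ {A} {R} R-sym xs↭ys = ↭ₛ.AllPairs-resp-↭ (setoid A) R-sym (resp₂ R) (↭⇒↭ₛ xs↭ys)

Unique-resp-↭ : ∀ {A : Set} {xs ys : List A} → xs ↭ ys → Unique xs → Unique ys
Unique-resp-↭ = AllPairs-resp-↭ (λ x≢y y≡x → x≢y (sym y≡x))

AllPairs-lookup : ∀ {A : Set} {R : Rel A 0ℓ} → Symmetric R → ∀ {xs : List A} → AllPairs R xs →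
  ∀ i j → i ≢ j → R (lookup xs i) (lookup xs j)
AllPairs-lookup R-sym (px ∷ pxs) zero    zero    i≢j = contradiction refl i≢j
AllPairs-lookup R-sym (px ∷ pxs) zero    (suc j) i≢j = All.lookup px (∈-lookup j)
AllPairs-lookup R-sym (px ∷ pxs) (suc i) zero    i≢j = R-sym (All.lookup px (∈-lookup i))
AllPairs-lookup R-sym (px ∷ pxs) (suc i) (suc j) i≢j = AllPairs-lookup R-sym pxs i j (i≢j ∘ cong suc)

-- A permutation of a + 1, ..., b phrased through membership, a form that passes to the two pieces
-- of a word cut at its least letter.
Enumerates : ℕ → ℕ → List ℕ → Set
Enumerates a b w = Unique w × (∀ {p} → p ∈ w → a < p × p ≤ b) × (∀ {p} → a < p → p ≤ b → p ∈ w)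

∈-[1⋯]⁻ : ∀ n {p} → p ∈ [1⋯ n ] → 0 < p × p ≤ n
∈-[1⋯]⁻ n p∈ with ∈-map⁻ suc p∈
... | q , q∈ , refl = s≤s z≤n , ∈-upTo⁻ q∈

∈-[1⋯]⁺ : ∀ n {p} → 0 < p → p ≤ n → p ∈ [1⋯ n ]
∈-[1⋯]⁺ n {suc p} _ p≤n = ∈-map⁺ suc (∈-upTo⁺ p≤n)

Unique-[1⋯] : ∀ n → Unique [1⋯ n ]
Unique-[1⋯] n = Unique.map⁺ suc-injective (Unique.upTo⁺ n)

Enumerates⇒↭ : ∀ {n w} → Enumerates 0 n w → w ↭ [1⋯ n ]
Enumerates⇒↭ {n} (w! , ⊆ , ⊇) = ∼bag⇒↭ (unique∧set⇒bag w! (Unique-[1⋯] n)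
  (mk⇔ (uncurry (∈-[1⋯]⁺ n) ∘ ⊆) (uncurry ⊇ ∘ ∈-[1⋯]⁻ n)))

↭⇒Enumerates : ∀ {n w} → w ↭ [1⋯ n ] → Enumerates 0 n w
↭⇒Enumerates {n} w↭ = Unique-resp-↭ (↭-sym w↭) (Unique-[1⋯] n)
  , ∈-[1⋯]⁻ n ∘ ∈-resp-↭ w↭ , λ 0<p p≤n → ∈-resp-↭ (↭-sym w↭) (∈-[1⋯]⁺ n 0<p p≤n)

-- Blocks, slashes and descents.

IncreasingBlock : Block → Set
IncreasingBlock b = Linked _<_ (letters b)

minB∈ : ∀ b → minB b ∈ letters b
minB∈ (x ∷ xs) = go x xs
  where
  go : ∀ x xs → minB (x ∷ xs) ∈ x ∷ xs
  go x []       = here refl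
  go x (y ∷ ys) = [ here , (λ eq → there (subst (_∈ y ∷ ys) (sym eq) (go y ys))) ]′ (⊓-sel x (minB (y ∷ ys)))

minB≤ : ∀ b {p} → p ∈ letters b → minB b ≤ p
minB≤ (x ∷ [])     (here refl) = ≤-refl
minB≤ (x ∷ y ∷ ys) (here refl) = m⊓n≤m x (minB (y ∷ ys))
minB≤ (x ∷ y ∷ ys) (there p∈)  = ≤-trans (m⊓n≤n x (minB (y ∷ ys))) (minB≤ (y ∷ ys) p∈)

≤maxB : ∀ b {p} → p ∈ letters b → p ≤ maxB b
≤maxB (x ∷ [])     (here refl) = ≤-refl
≤maxB (x ∷ y ∷ ys) (here refl) = m≤m⊔n x (maxB (y ∷ ys))
≤maxB (x ∷ y ∷ ys) (there p∈)  = ≤-trans (≤maxB (y ∷ ys) p∈) (m≤n⊔m x (maxB (y ∷ ys)))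

increasing⇒AllPairs : ∀ b → IncreasingBlock b → AllPairs _<_ (letters b)
increasing⇒AllPairs b = Linked⇒AllPairs <-trans

increasing⇒Unique : ∀ b → IncreasingBlock b → Unique (letters b)
increasing⇒Unique b b↗ = AllPairs.map <⇒≢ (increasing⇒AllPairs b b↗)

minB-increasing : ∀ b → IncreasingBlock b → minB b ≡ List⁺.head b
minB-increasing (x ∷ xs) b↗ with minB∈ (x ∷ xs) | increasing⇒AllPairs (x ∷ xs) b↗
... | here eq  | _         = eq
... | there m∈ | x<xs ∷ _ = contradiction (minB≤ (x ∷ xs) (here refl)) (<⇒≱ (All.lookup x<xs m∈))

Descent : Block → Block → Set
Descent b c = maxB b > minB c

-- Keeps the resulting equation next to the comparison, so that later proofs can abstract over the
-- value of `prependLetter` and its case together.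
prepend-cases : ∀ x b bs →
  x < List⁺.head b × prependLetter x (b ∷ bs) ≡ (x ∷⁺ b) ∷ bs
  ⊎ ¬ x < List⁺.head b × prependLetter x (b ∷ bs) ≡ List⁺.[ x ] ∷ b ∷ bs
prepend-cases x b bs with x <? List⁺.head b
... | yes x<h = inj₁ (x<h , cong (λ c → if c then (x ∷⁺ b) ∷ bs else List⁺.[ x ] ∷ b ∷ bs) (dec-true (x <? List⁺.head b) x<h))
... | no  x≮h = inj₂ (x≮h , cong (λ c → if c then (x ∷⁺ b) ∷ bs else List⁺.[ x ] ∷ b ∷ bs) (dec-false (x <? List⁺.head b) x≮h))

prepend-< : ∀ {x} b bs → x < List⁺.head b → prependLetter x (b ∷ bs) ≡ (x ∷⁺ b) ∷ bs
prepend-< {x} b bs x<h with prepend-cases x b bs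
... | inj₁ (_ , eq)  = eq
... | inj₂ (x≮h , _) = contradiction x<h x≮h

prepend-≮ : ∀ {x} b bs → ¬ x < List⁺.head b → prependLetter x (b ∷ bs) ≡ List⁺.[ x ] ∷ b ∷ bs
prepend-≮ {x} b bs x≮h with prepend-cases x b bs
... | inj₁ (x<h , _) = contradiction x<h x≮h
... | inj₂ (_ , eq)  = eq

word-prepend : ∀ x bs → word (prependLetter x bs) ≡ x ∷ word bs
word-prepend x []       = refl
word-prepend x (b ∷ bs) with prependLetter x (b ∷ bs) | prepend-cases x b bs
... | _ | inj₁ (_ , refl) = refl
... | _ | inj₂ (_ , refl) = refl

word-slash : ∀ w → word (slash w) ≡ w
word-slash []      = refl
word-slash (x ∷ w) = trans (word-prepend x (slash w)) (cong (x ∷_) (word-slash w))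

∷⁺-increasing : ∀ {x} b → x < List⁺.head b → IncreasingBlock b → IncreasingBlock (x ∷⁺ b)
∷⁺-increasing (y ∷ ys) x<y b↗ = x<y ∷ b↗

slash-increasing : ∀ w → All IncreasingBlock (slash w)
slash-increasing []      = []
slash-increasing (x ∷ w) = prepend-increasing (slash w) (slash-increasing w)
  where
  prepend-increasing : ∀ bs → All IncreasingBlock bs → All IncreasingBlock (prependLetter x bs)
  prepend-increasing []       []         = [-] ∷ []
  prepend-increasing (b ∷ bs) (b↗ ∷ bs↗) with prependLetter x (b ∷ bs) | prepend-cases x b bs
  ... | _ | inj₁ (x<h , refl) = ∷⁺-increasing b x<h b↗ ∷ bs↗
  ... | _ | inj₂ (_   , refl) = [-] ∷ b↗ ∷ bs↗

Linked-replace-head : ∀ {A : Set} {R : Rel A 0ℓ} {x y} {xs : List A} →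
  (∀ {z} → R x z → R y z) → Linked R (x ∷ xs) → Linked R (y ∷ xs)
Linked-replace-head f [-]          = [-]
Linked-replace-head f (Rxz ∷ Rxs) = f Rxz ∷ Rxs

-- At a slash the failed test leaves head ≤ x. Distinct letters make this strict, and the head of an
-- increasing block is its minimum.
slash-descents : ∀ {w} → Unique w → Linked Descent (slash w)
slash-descents {[]}    _          = []
slash-descents {x ∷ w} (x∉w ∷ w!) = prepend-descents (slash w) (slash-increasing w) (slash-descents w!)
  (λ {p} p∈ → All.lookup x∉w (subst (p ∈_) (word-slash w) p∈))
  where
  maxB-∷⁺ : ∀ b → maxB b ≤ maxB (x ∷⁺ b)
  maxB-∷⁺ (y ∷ ys) = m≤n⊔m x (maxB (y ∷ ys))
  prepend-descents : ∀ bs → All IncreasingBlock bs → Linked Descent bs → (∀ {p} → p ∈ word bs → x ≢ p) →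
    Linked Descent (prependLetter x bs)
  prepend-descents []       _        _   _   = [-]
  prepend-descents (b ∷ bs) (b↗ ∷ _) bs↘ x∉ with prependLetter x (b ∷ bs) | prepend-cases x b bs
  ... | _ | inj₁ (_   , refl) = Linked-replace-head (λ d → <-≤-trans d (maxB-∷⁺ b)) bs↘
  ... | _ | inj₂ (x≮h , refl) = subst (_< x) (sym (minB-increasing b b↗))
          (≤∧≢⇒< (≮⇒≥ x≮h) (λ h≡x → x∉ (here refl) (sym h≡x))) ∷ bs↘

slash-NCCP : ∀ {n w} → w ↭ [1⋯ n ] → NCCP n (slash w)
slash-NCCP {w = w} w↭ = record
  { exactlyOnce = subst (_↭ _) (sym (word-slash w)) w↭
  ; increasing  = slash-increasing w
  ; descents    = slash-descents (proj₁ (↭⇒Enumerates w↭))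
  }

-- Letters are prepended from the right: the last letter of the block meets π, where the descent
-- forces a slash, and every other letter meets a larger one.
prepend-block : ∀ x xs π → IncreasingBlock (x ∷ xs) → All IncreasingBlock π → Linked Descent ((x ∷ xs) ∷ π) →
  foldr prependLetter π (x ∷ xs) ≡ (x ∷ xs) ∷ π
prepend-block x []       []       _            _        _       = refl
prepend-block x []       (c ∷ cs) _            (c↗ ∷ _) (d ∷ _) =
  prepend-≮ c cs (λ x<h → <⇒≯ x<h (subst (_< x) (minB-increasing c c↗) d))
prepend-block x (y ∷ ys) π        (x<y ∷ ys↗) π↗       π↘      = trans
  (cong (prependLetter x)
    (prepend-block y ys π ys↗ π↗ (Linked-replace-head (λ {c} d → <-≤-trans d max≤) π↘)))
  (prepend-< (y ∷ ys) π x<y)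
  where
  max≤ : maxB (x ∷ y ∷ ys) ≤ maxB (y ∷ ys)
  max≤ = ⊔-lub (≤-trans (<⇒≤ x<y) (≤maxB (y ∷ ys) (here refl))) ≤-refl

slash-word : ∀ {π} → All IncreasingBlock π → Linked Descent π → slash (word π) ≡ π
slash-word {[]}           []        []  = refl
slash-word {(x ∷ xs) ∷ π} (b↗ ∷ π↗) π↘ = trans (List.foldr-++ prependLetter [] (x ∷ xs) (word π))
  (trans (cong (λ s → foldr prependLetter s (x ∷ xs)) (slash-word π↗ (Linked.tail π↘)))
    (prepend-block x xs π b↗ π↗ π↘))

slash-word-NCCP : ∀ {n π} → NCCP n π → slash (word π) ≡ π
slash-word-NCCP nccp = slash-word (NCCP.increasing nccp) (NCCP.descents nccp)

-- Noncrossing canonical partitions.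

Crossing-free : Block → Block → Set
Crossing-free b c = ∀ {p q r s} → p < q → q < r → r < s →
  p ∈ letters b → r ∈ letters b → q ∈ letters c → s ∈ letters c → ⊥

-- Made symmetric so that `AllPairs` along the list covers all pairs of distinct indices.
Separate : Block → Block → Set
Separate b c = Crossing-free b c × Crossing-free c b

Separate-sym : ∀ {b c} → Separate b c → Separate c b
Separate-sym (f , g) = g , f

mkNCP : ∀ {n π} → word π ↭ [1⋯ n ] → All IncreasingBlock π → AllPairs (λ b c → minB b > minB c) π →
  AllPairs Separate π → NCP n π
mkNCP {n} {π} w↭ π↗ π-can π-sep = record
  { nccp        = record
    { exactlyOnce = w↭
    ; increasing  = π↗
    -- Decreasing minima already give descents, since max b ≥ min b > min c.
    ; descents    = Linked.map (λ {b} {c} m → <-≤-trans m (≤-trans (minB≤ b (minB∈ b)) (≤maxB b (minB∈ b))))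
                      (AllPairs⇒Linked π-can)
    }
  ; nonCrossing = λ i j i≢j → proj₁ (AllPairs-lookup {R = Separate} Separate-sym π-sep i j i≢j)
  ; canonical   = AllPairs⇒Linked π-can
  }

-- Avoidance of 312.

embed : ∀ {xs ys : List ℕ} → xs ⊆ ys → Fin (length xs) → Fin (length ys)
embed (y ∷ʳ τ)    i       = suc (embed τ i)
embed (refl ∷ τ) zero    = zero
embed (refl ∷ τ) (suc i) = suc (embed τ i)

embed-mono : ∀ {xs ys : List ℕ} (τ : xs ⊆ ys) i j → i Fin.< j → embed τ i Fin.< embed τ j
embed-mono (y ∷ʳ τ)    i       j       i<j       = s≤s (embed-mono τ i j i<j)
embed-mono (refl ∷ τ) zero    (suc j) i<j       = s≤s z≤n
embed-mono (refl ∷ τ) (suc i) (suc j) (s≤s i<j) = s≤s (embed-mono τ i j i<j)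

lookup-embed : ∀ {xs ys : List ℕ} (τ : xs ⊆ ys) i → lookup ys (embed τ i) ≡ lookup xs i
lookup-embed (y ∷ʳ τ)    i       = lookup-embed τ i
lookup-embed (refl ∷ τ) zero    = refl
lookup-embed (refl ∷ τ) (suc i) = lookup-embed τ i

-- Sublists instead of index functions, so that avoidance restricts to pieces of a word by composing
-- sublists.
Avoids : List ℕ → Set
Avoids w = ∀ {a b c} → a ∷ b ∷ c ∷ [] ⊆ w → b < c → c < a → ⊥

avoid312⇒Avoids : ∀ {w} → ¬ Contains p312 w → Avoids w
avoid312⇒Avoids {w} avoid {a} {b} {c} τ b<c c<a = avoid (embed τ , embed-mono τ , λ i j →
  subst₂ (λ u v → lookup p312 i < lookup p312 j ⇔ u < v)
    (sym (lookup-embed τ i)) (sym (lookup-embed τ j)) (iso i j))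
  where
  yes⇔ : ∀ {P Q : Set} → P → Q → P ⇔ Q
  yes⇔ p q = mk⇔ (λ _ → q) (λ _ → p)
  no⇔ : ∀ {P Q : Set} → ¬ P → ¬ Q → P ⇔ Q
  no⇔ ¬p ¬q = mk⇔ (⊥-elim ∘ ¬p) (⊥-elim ∘ ¬q)
  1<2 : 1 < 2
  1<2 = ≤-refl
  2<3 : 2 < 3
  2<3 = ≤-refl
  1<3 : 1 < 3
  1<3 = <-trans 1<2 2<3
  iso : ∀ i j → lookup p312 i < lookup p312 j ⇔ lookup (a ∷ b ∷ c ∷ []) i < lookup (a ∷ b ∷ c ∷ []) j
  iso zero             zero             = no⇔ (<-irrefl refl) (<-irrefl refl)
  iso zero             (suc zero)       = no⇔ (<-asym 1<3) (<-asym (<-trans b<c c<a))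
  iso zero             (suc (suc zero)) = no⇔ (<-asym 2<3) (<-asym c<a)
  iso (suc zero)       zero             = yes⇔ 1<3 (<-trans b<c c<a)
  iso (suc zero)       (suc zero)       = no⇔ (<-irrefl refl) (<-irrefl refl)
  iso (suc zero)       (suc (suc zero)) = yes⇔ 1<2 b<c
  iso (suc (suc zero)) zero             = yes⇔ 2<3 c<a
  iso (suc (suc zero)) (suc zero)       = no⇔ (<-asym 1<2) (<-asym b<c)
  iso (suc (suc zero)) (suc (suc zero)) = no⇔ (<-irrefl refl) (<-irrefl refl)

lookup₁-⊆ : ∀ (w : List ℕ) i → lookup w i ∷ [] ⊆ w
lookup₁-⊆ (x ∷ w) zero    = refl ∷ minimum w
lookup₁-⊆ (x ∷ w) (suc i) = x ∷ʳ lookup₁-⊆ w i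

lookup₂-⊆ : ∀ (w : List ℕ) i j → i Fin.< j → lookup w i ∷ lookup w j ∷ [] ⊆ w
lookup₂-⊆ (x ∷ w) zero    (suc j) i<j       = refl ∷ lookup₁-⊆ w j
lookup₂-⊆ (x ∷ w) (suc i) (suc j) (s≤s i<j) = x ∷ʳ lookup₂-⊆ w i j i<j

lookup₃-⊆ : ∀ (w : List ℕ) i j k → i Fin.< j → j Fin.< k → lookup w i ∷ lookup w j ∷ lookup w k ∷ [] ⊆ w
lookup₃-⊆ (x ∷ w) zero    (suc j) (suc k) i<j       (s≤s j<k) = refl ∷ lookup₂-⊆ w j k j<k
lookup₃-⊆ (x ∷ w) (suc i) (suc j) (suc k) (s≤s i<j) (s≤s j<k) = x ∷ʳ lookup₃-⊆ w i j k i<j j<k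

Avoids⇒avoid312 : ∀ {w} → Avoids w → ¬ Contains p312 w
Avoids⇒avoid312 {w} avoid (f , mono , iso) = avoid
  (lookup₃-⊆ w (f zero) (f (suc zero)) (f (suc (suc zero))) (mono _ _ ≤-refl) (mono _ _ ≤-refl))
  (Equivalence.to (iso (suc zero) (suc (suc zero))) ≤-refl)
  (Equivalence.to (iso (suc (suc zero)) zero) ≤-refl)

-- In-order words of increasing trees.

toDiffList-++ : ∀ (t : BinTree) xs → Infix.toDiffList t xs ≡ Infix.toList t ++ xs
toDiffList-++ (leaf _)     xs = refl
toDiffList-++ (node l x r) xs = begin
  Infix.toDiffList l (x ∷ Infix.toDiffList r xs)
    ≡⟨ toDiffList-++ l _ ⟩
  Infix.toList l ++ x ∷ Infix.toDiffList r xs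
    ≡⟨ cong (λ ys → Infix.toList l ++ x ∷ ys) (toDiffList-++ r xs) ⟩
  Infix.toList l ++ (x ∷ Infix.toList r) ++ xs
    ≡⟨ ++-assoc (Infix.toList l) (x ∷ Infix.toList r) xs ⟨
  (Infix.toList l ++ x ∷ Infix.toList r) ++ xs
    ≡⟨ cong (_++ xs) (toDiffList-++ l (x ∷ Infix.toList r)) ⟨
  Infix.toList (node l x r) ++ xs ∎
  where open ≡-Reasoning

toList-node : ∀ (l : BinTree) x r → Infix.toList (node l x r) ≡ Infix.toList l ++ x ∷ Infix.toList r
toList-node l x r = toDiffList-++ l (x ∷ Infix.toList r)

word-φ : ∀ t → word (φ t) ≡ Infix.toList t
word-φ t = word-slash (Infix.toList t)

All-toList : ∀ {P : ℕ → Set} {t} → Tree.All P (λ _ → ⊤) t → All P (Infix.toList t)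
All-toList (Tree.leaf _) = []
All-toList {t = node l x r} (Tree.node pl px pr) = subst (All _) (sym (toList-node l x r))
  (All.++⁺ (All-toList pl) (px ∷ All-toList pr))

-- The root is the least letter, which forces the place of the cut: with two different cuts each
-- root would be smaller than the other.
min-split-unique : ∀ {x x′ : ℕ} {L L′ R R′} → All (x <_) L → All (x <_) R → All (x′ <_) L′ → All (x′ <_) R′ →
  L ++ x ∷ R ≡ L′ ++ x′ ∷ R′ → L ≡ L′ × x ≡ x′ × R ≡ R′
min-split-unique []        _  []          _  refl = refl , refl , refl
min-split-unique []        xR (x′<x ∷ _)  _  refl =
  contradiction (All.lookup xR (∈-insert _)) (<-asym x′<x)
min-split-unique (x<x′ ∷ _) _ []          xR refl =
  contradiction (All.lookup xR (∈-insert _)) (<-asym x<x′)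
min-split-unique (_ ∷ xL) xR (_ ∷ xL′) xR′ eq
  with ∷-injectiveˡ eq | min-split-unique xL xR xL′ xR′ (∷-injectiveʳ eq)
... | refl | refl , refl , refl = refl , refl , refl

-- Injectivity of `φ`, on which the single-valuedness of `ψ∘φ⁻¹` rests.
heap-unique : ∀ {t t′} → Increasing t → Increasing t′ → Infix.toList t ≡ Infix.toList t′ → t ≡ t′
heap-unique leaf leaf _ = refl
heap-unique leaf (node {l} {x} {r} _ _ _ _) eq =
  contradiction (subst (x ∈_) (sym (trans eq (toList-node l x r))) (∈-insert (Infix.toList l))) λ ()
heap-unique (node {l} {x} {r} _ _ _ _) leaf eq =
  contradiction (subst (x ∈_) (trans (sym (toList-node l x r)) eq) (∈-insert (Infix.toList l))) λ ()
heap-unique (node {l} {x} {r} xl xr l↗ r↗) (node {l′} {x′} {r′} xl′ xr′ l′↗ r′↗) eq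
  with min-split-unique (All-toList xl) (All-toList xr) (All-toList xl′) (All-toList xr′)
         (trans (sym (toList-node l x r)) (trans eq (toList-node l′ x′ r′)))
... | eql , refl , eqr = cong₂ (λ l r → node l x r) (heap-unique l↗ l′↗ eql) (heap-unique r↗ r′↗ eqr)

-- Preorder labels and 312-avoiding words.

-- The labels in preorder are a + 1, …, b.
data Preorder : ℕ → BinTree → ℕ → Set where
  leaf : ∀ {a u} → Preorder a (leaf u) a
  node : ∀ {a b c l r} → Preorder (suc a) l c → Preorder c r b → Preorder a (node l (suc a) r) b

preorder-≤ : ∀ {a b t} → Preorder a t b → a ≤ b
preorder-≤ leaf         = ≤-refl
preorder-≤ (node pl pr) = ≤-trans (n≤1+n _) (≤-trans (preorder-≤ pl) (preorder-≤ pr))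

labels⁻ : ∀ {a b t p} → Preorder a t b → p ∈ Infix.toList t → a < p × p ≤ b
labels⁻ {t = node l x r} (node pl pr) p∈
  with ∈-++⁻ (Infix.toList l) (subst (_ ∈_) (toList-node l x r) p∈)
... | inj₁ p∈l = let a<p , p≤c = labels⁻ pl p∈l in <-trans (n<1+n _) a<p , ≤-trans p≤c (preorder-≤ pr)
... | inj₂ (here refl) = ≤-refl , ≤-trans (preorder-≤ pl) (preorder-≤ pr)
... | inj₂ (there p∈r) = let c<p , p≤b = labels⁻ pr p∈r in ≤-<-trans (<⇒≤ (preorder-≤ pl)) c<p , p≤b

labels⁺ : ∀ {a b t p} → Preorder a t b → a < p → p ≤ b → p ∈ Infix.toList t
labels⁺ leaf a<p p≤a = contradiction a<p (≤⇒≯ p≤a)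
labels⁺ {t = node l x r} {p} (node {a} {c = c} pl pr) a<p p≤b =
  subst (p ∈_) (sym (toList-node l x r)) (position (m≤n⇒m<n∨m≡n a<p) (≤-<-connex p c))
  where
  position : suc a < p ⊎ suc a ≡ p → p ≤ c ⊎ c < p → p ∈ Infix.toList l ++ x ∷ Infix.toList r
  position (inj₂ refl)  _          = ∈-insert (Infix.toList l)
  position (inj₁ x<p)   (inj₁ p≤c) = ∈-++⁺ˡ (labels⁺ pl x<p p≤c)
  position (inj₁ _)     (inj₂ c<p) = ∈-++⁺ʳ (Infix.toList l) (there (labels⁺ pr c<p p≤b))

labels-unique : ∀ {a b t} → Preorder a t b → Unique (Infix.toList t)
labels-unique leaf = []
labels-unique {t = node l x r} (node pl pr) = subst Unique (sym (toList-node l x r))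
  (AllPairs.++⁺ (labels-unique pl)
    (All.tabulate (λ q∈ → <⇒≢ (≤-<-trans (preorder-≤ pl) (proj₁ (labels⁻ pr q∈)))) ∷ labels-unique pr)
    (All.tabulate (λ p∈ → let x<p , p≤c = labels⁻ pl p∈ in
      >⇒≢ x<p ∷ All.tabulate (λ q∈ → <⇒≢ (≤-<-trans p≤c (proj₁ (labels⁻ pr q∈)))))))

preorder-Enumerates : ∀ {a b t} → Preorder a t b → Enumerates a b (Infix.toList t)
preorder-Enumerates pt = labels-unique pt , labels⁻ pt , labels⁺ pt

preorder-All : ∀ {a b t} {P : ℕ → Set} → Preorder a t b → (∀ {p} → a < p → p ≤ b → P p) → Tree.All P (λ _ → ⊤) t
preorder-All leaf f = Tree.leaf tt
preorder-All (node pl pr) f = Tree.node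
  (preorder-All pl (λ x<p p≤c → f (<-trans (n<1+n _) x<p) (≤-trans p≤c (preorder-≤ pr))))
  (f ≤-refl (≤-trans (preorder-≤ pl) (preorder-≤ pr)))
  (preorder-All pr (λ c<p → f (≤-<-trans (<⇒≤ (preorder-≤ pl)) c<p)))

preorder-Increasing : ∀ {a b t} → Preorder a t b → Increasing t
preorder-Increasing leaf = leaf
preorder-Increasing (node pl pr) = node
  (preorder-All pl (λ x<p _ → x<p))
  (preorder-All pr (λ c<p _ → ≤-<-trans (preorder-≤ pl) c<p))
  (preorder-Increasing pl) (preorder-Increasing pr)

preorder-LabeledTree : ∀ {n t} → Preorder 0 t n → LabeledTree n t
preorder-LabeledTree pt = record
  { labels     = Enumerates⇒↭ (preorder-Enumerates pt)
  ; increasing = preorder-Increasing pt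
  }

⊆-split : ∀ {L R : List ℕ} {w} → w ⊆ L ++ R → ∃[ u ] ∃[ v ] w ≡ u ++ v × u ⊆ L × v ⊆ R
⊆-split {[]}    τ = [] , _ , refl , [] , τ
⊆-split {x ∷ L} (.x ∷ʳ τ) with ⊆-split {L} τ
... | u , v , refl , τu , τv = u , v , refl , x ∷ʳ τu , τv
⊆-split {x ∷ L} (refl ∷ τ) with ⊆-split {L} τ
... | u , v , refl , τu , τv = x ∷ u , v , refl , refl ∷ τu , τv

⊆⇒∈ : ∀ {x : ℕ} {xs w} → x ∷ xs ⊆ w → x ∈ w
⊆⇒∈ τ = Sub.to∈ (⊆-trans (refl ∷ minimum _) τ)

-- Cases by how many of the three letters fall in l. The root is least and labels of l precede
-- labels of r, so b < c < a survives only within a single subtree.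
preorder-Avoids : ∀ {a b t} → Preorder a t b → Avoids (Infix.toList t)
preorder-Avoids {t = node l x r} (node {c = m} pl pr) {a} {b} {c} τ b<c c<a
  with ⊆-split {Infix.toList l} (subst (_ ⊆_) (toList-node l x r) τ)
... | [] , _ , refl , _ , refl ∷ τ′ =
      <-asym (<-trans b<c c<a) (≤-<-trans (preorder-≤ pl) (proj₁ (labels⁻ pr (⊆⇒∈ τ′))))
... | [] , _ , refl , _ , _ ∷ʳ τ′ = preorder-Avoids pr τ′ b<c c<a
... | a ∷ [] , _ , refl , τl , τr =
      <-asym c<a (≤-<-trans (proj₂ (labels⁻ pl (⊆⇒∈ τl))) (proj₁ (labels⁻ pr (⊆⇒∈ (Sublist.∷⁻ τr)))))
... | a ∷ b ∷ [] , _ , refl , τl , refl ∷ _ = <-asym b<c (proj₁ (labels⁻ pl (⊆⇒∈ (Sublist.∷ˡ⁻ τl))))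
... | a ∷ b ∷ [] , _ , refl , τl , _ ∷ʳ τr =
      <-asym c<a (≤-<-trans (proj₂ (labels⁻ pl (⊆⇒∈ τl))) (proj₁ (labels⁻ pr (⊆⇒∈ τr))))
... | a ∷ b ∷ c ∷ [] , [] , refl , τl , _ = preorder-Avoids pl τl b<c c<a

AllPairs-++⁻ : ∀ {A : Set} {R : Rel A 0ℓ} xs {ys : List A} → AllPairs R (xs ++ ys) →
  AllPairs R xs × AllPairs R ys × (∀ {x y} → x ∈ xs → y ∈ ys → R x y)
AllPairs-++⁻ []       ys↗ = [] , ys↗ , λ ()
AllPairs-++⁻ (x ∷ xs) (px ∷ pxs) with AllPairs-++⁻ xs pxs
... | xs↗ , ys↗ , cross = (All.++⁻ˡ xs px ∷ xs↗) , ys↗ ,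
  λ { (here refl) y∈ → All.lookup (All.++⁻ʳ xs px) y∈ ; (there x∈) y∈ → cross x∈ y∈ }

-- a stands in for the maximum of an empty list.
upper : ∀ a L → ∃[ c ] (∀ {p} → p ∈ L → p ≤ c) × (c ≡ a ⊎ c ∈ L)
upper a []      = a , (λ ()) , inj₁ refl
upper a (x ∷ L) with upper a L
... | c , L≤c , attained with ≤-total c x
...   | inj₁ c≤x = x , (λ { (here refl) → ≤-refl ; (there p∈) → ≤-trans (L≤c p∈) c≤x }) , inj₂ (here refl)
...   | inj₂ x≤c = c , (λ { (here refl) → x≤c ; (there p∈) → L≤c p∈ }) , [ inj₁ , inj₂ ∘ there ]′ attained

-- Cut at the least letter. Avoidance puts L entirely below R, so both are intervals meeting at c =
-- max L; for empty L, c is a + 1 and the interval of L is empty.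
decompose : ∀ {a b w} → a < b → Enumerates a b w → Avoids w →
  ∃[ L ] ∃[ R ] ∃[ c ] w ≡ L ++ suc a ∷ R × suc a ≤ c × c ≤ b × Enumerates (suc a) c L × Enumerates c b R
decompose {a} {b} a<b (w! , ⊆ , ⊇) avoid with ∈-∃++ (⊇ (n<1+n a) a<b)
... | L , R , refl with AllPairs-++⁻ L w! | upper (suc a) L
...   | L! , x∉R ∷ R! , distinct | c , L≤c , attained =
  L , R , c , refl , x≤c , c≤b
  , (L! , (λ p∈ → x<L p∈ , L≤c p∈) , L⊇)
  , (R! , (λ p∈ → c<R p∈ , proj₂ (⊆ (∈-++⁺ʳ L (there p∈)))) , R⊇)
  where
  x<L : ∀ {p} → p ∈ L → suc a < p
  x<L p∈ = ≤∧≢⇒< (proj₁ (⊆ (∈-++⁺ˡ p∈))) (distinct p∈ (here refl) ∘ sym)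
  x<R : ∀ {p} → p ∈ R → suc a < p
  x<R p∈ = ≤∧≢⇒< (proj₁ (⊆ (∈-++⁺ʳ L (there p∈)))) (All.lookup x∉R p∈)
  L<R : ∀ {p q} → p ∈ L → q ∈ R → p < q
  -- If q < p, the letters p, a + 1, q form a 312.
  L<R {p} {q} p∈ q∈ = ≤∧≢⇒< (≮⇒≥ (avoid (Sublist.++⁺ (Sub.from∈ p∈) (refl ∷ Sub.from∈ q∈)) (x<R q∈)))
    (distinct p∈ (there q∈))
  x≤c : suc a ≤ c
  x≤c = [ ≤-reflexive ∘ sym , <⇒≤ ∘ x<L ]′ attained
  c≤b : c ≤ b
  c≤b = [ (λ { refl → a<b }) , (λ c∈ → proj₂ (⊆ (∈-++⁺ˡ c∈))) ]′ attained
  c<R : ∀ {q} → q ∈ R → c < q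
  c<R q∈ = [ (λ { refl → x<R q∈ }) , (λ c∈ → L<R c∈ q∈) ]′ attained
  L⊇ : ∀ {p} → suc a < p → p ≤ c → p ∈ L
  L⊇ x<p p≤c with ∈-++⁻ L (⊇ (<-trans (n<1+n a) x<p) (≤-trans p≤c c≤b))
  ... | inj₁ p∈L         = p∈L
  ... | inj₂ (here refl) = contradiction x<p (<-irrefl refl)
  ... | inj₂ (there p∈R) = contradiction (c<R p∈R) (≤⇒≯ p≤c)
  R⊇ : ∀ {p} → c < p → p ≤ b → p ∈ R
  R⊇ c<p p≤b with ∈-++⁻ L (⊇ (≤-<-trans (<⇒≤ x≤c) c<p) p≤b)
  ... | inj₁ p∈L         = contradiction c<p (≤⇒≯ (L≤c p∈L))
  ... | inj₂ (here refl) = contradiction c<p (≤⇒≯ x≤c)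
  ... | inj₂ (there p∈R) = p∈R

-- k bounds b - a and makes the recursion structural.
tree-of-word : ∀ k {a b w} → b ≤ a + k → a ≤ b → Enumerates a b w → Avoids w →
  ∃[ t ] Preorder a t b × Infix.toList t ≡ w
tree-of-word k {a} {b} {w} b≤a+k a≤b enum avoid with m≤n⇒m<n∨m≡n a≤b
tree-of-word k {w = []}    _ _ _           _ | inj₂ refl = leaf tt , leaf , refl
tree-of-word k {w = x ∷ w} _ _ (_ , ⊆ , _) _ | inj₂ refl =
  let a<x , x≤a = ⊆ (here refl) in contradiction a<x (≤⇒≯ x≤a)
tree-of-word zero    {a} b≤a+k a≤b enum avoid | inj₁ a<b =
  contradiction a<b (≤⇒≯ (subst (_ ≤_) (+-identityʳ a) b≤a+k))
tree-of-word (suc k) {a} {b} b≤a+k a≤b enum avoid | inj₁ a<b with decompose a<b enum avoid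
... | L , R , c , refl , x≤c , c≤b , enumL , enumR
  with tree-of-word k (≤-trans c≤b b≤1+a+k) x≤c enumL (λ τ → avoid (Sublist.++⁺ʳ (suc a ∷ R) τ))
     | tree-of-word k (≤-trans b≤1+a+k (+-monoˡ-≤ k x≤c)) c≤b enumR (λ τ → avoid (Sublist.++⁺ˡ L (suc a ∷ʳ τ)))
  where
  b≤1+a+k : b ≤ suc a + k
  b≤1+a+k = subst (b ≤_) (+-suc a k) b≤a+k
...     | l , pl , refl | r , pr , refl = node l (suc a) r , node pl pr , toList-node l (suc a) r

-- Chains of right edges.

∈-word⁺ : ∀ {p b π} → b ∈ π → p ∈ letters b → p ∈ word π
∈-word⁺ {p} b∈π p∈b = ∈-concatMap⁺ letters (Any.map (λ b≡ → subst (λ b → p ∈ letters b) b≡ p∈b) b∈π)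

word-chains : ∀ t → word (chains t) ↭ Infix.toList t
word-chainsBelow : ∀ t → rightSpine t ++ word (chainsBelow t) ↭ Infix.toList t

word-chains (leaf _)       = ↭-refl
word-chains t@(node _ _ _) = word-chainsBelow t

word-chainsBelow (leaf _)     = ↭-refl
word-chainsBelow (node l x r) = begin
  x ∷ rightSpine r ++ word (chains l ++ chainsBelow r)
    ≡⟨ cong (λ w → x ∷ rightSpine r ++ w) (concatMap-++ letters (chains l) (chainsBelow r)) ⟩
  x ∷ rightSpine r ++ word (chains l) ++ word (chainsBelow r)
    ↭⟨ prep x (shifts (rightSpine r) (word (chains l))) ⟩
  x ∷ word (chains l) ++ rightSpine r ++ word (chainsBelow r)
    ↭⟨ prep x (++⁺ (word-chains l) (word-chainsBelow r)) ⟩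
  x ∷ Infix.toList l ++ Infix.toList r
    ↭⟨ shift x (Infix.toList l) (Infix.toList r) ⟨
  Infix.toList l ++ x ∷ Infix.toList r
    ≡⟨ toList-node l x r ⟨
  Infix.toList (node l x r) ∎
  where open PermutationReasoning

chains-bounds : ∀ {a b t B p} → Preorder a t b → B ∈ chains t → p ∈ letters B → a < p × p ≤ b
chains-bounds {t = t} pt B∈ p∈ = labels⁻ pt (∈-resp-↭ (word-chains t) (∈-word⁺ B∈ p∈))

spine-bounds : ∀ {a b t p} → Preorder a t b → p ∈ rightSpine t → a < p × p ≤ b
spine-bounds {t = t} pt p∈ = labels⁻ pt (∈-resp-↭ (word-chainsBelow t) (∈-++⁺ˡ p∈))

-- The lower bound gains one over `chains-bounds`: the root a + 1 lies on the omitted chain.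
chainsBelow-bounds : ∀ {a b t B p} → Preorder a t b → B ∈ chainsBelow t → p ∈ letters B → suc a < p × p ≤ b
chainsBelow-bounds {t = node l x r} (node pl pr) B∈ p∈ with ∈-++⁻ (chains l) B∈
... | inj₁ B∈l = let x<p , p≤c = chains-bounds pl B∈l p∈ in x<p , ≤-trans p≤c (preorder-≤ pr)
... | inj₂ B∈r = let c<p , p≤b = chainsBelow-bounds pr B∈r p∈ in
                 ≤-<-trans (preorder-≤ pl) (<-trans (n<1+n _) c<p) , p≤b

spine-increasing : ∀ {a b t} → Preorder a t b → Linked _<_ (rightSpine t)
spine-increasing leaf                            = []
spine-increasing (node pl leaf)                  = [-]
spine-increasing (node pl pr@(node _ _)) = ≤-<-trans (preorder-≤ pl) (n<1+n _) ∷ spine-increasing pr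

chains-increasing      : ∀ {a b t} → Preorder a t b → All IncreasingBlock (chains t)
chainsBelow-increasing : ∀ {a b t} → Preorder a t b → All IncreasingBlock (chainsBelow t)

chains-increasing leaf            = []
chains-increasing pt@(node _ _) = spine-increasing pt ∷ chainsBelow-increasing pt

chainsBelow-increasing leaf         = []
chainsBelow-increasing (node pl pr) = All.++⁺ (chains-increasing pl) (chainsBelow-increasing pr)

MinB< : Block → Block → Set
MinB< B C = minB B < minB C

-- The chain through the root holds the least label, and all labels of l precede those of r, so
-- listing chains in preorder of their heads sorts them by minima.
chains-canonical      : ∀ {a b t} → Preorder a t b → AllPairs MinB< (chains t)
chainsBelow-canonical : ∀ {a b t} → Preorder a t b → AllPairs MinB< (chainsBelow t)

chains-canonical leaf = []
chains-canonical {t = node l x r} pt@(node _ _) =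
  All.tabulate (λ {C} C∈ → ≤-<-trans (minB≤ (x ∷ rightSpine r) (here refl))
    (proj₁ (chainsBelow-bounds pt C∈ (minB∈ C))))
  ∷ chainsBelow-canonical pt

chainsBelow-canonical leaf = []
chainsBelow-canonical (node pl pr) = AllPairs.++⁺ (chains-canonical pl) (chainsBelow-canonical pr)
  (All.tabulate λ {B} B∈ → All.tabulate λ {C} C∈ → ≤-<-trans (proj₂ (chains-bounds pl B∈ (minB∈ B)))
    (<-trans (n<1+n _) (proj₁ (chainsBelow-bounds pr C∈ (minB∈ C)))))

chains-separate      : ∀ {a b t} → Preorder a t b → AllPairs Separate (chains t)
-- The labels of l fill the gap between x and the rest of the spine, so its chains fit into one gap
-- of the root chain. For chains below r, the spine of r is merely preceded by a label smaller than
-- all of theirs.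
root-separate        : ∀ {a b l x r} → Preorder a (node l x r) b →
  All (Separate (x ∷ rightSpine r)) (chainsBelow (node l x r))
chainsBelow-separate : ∀ {a b t} → Preorder a t b → AllPairs Separate (chainsBelow t)

chains-separate leaf          = []
chains-separate pt@(node _ _) = root-separate pt ∷ chainsBelow-separate pt

root-separate {a} {l = l} {x} {r} (node {c = c} pl pr) = All.++⁺ (All.tabulate left) (right pr)
  where
  left : ∀ {C} → C ∈ chains l → Separate (x ∷ rightSpine r) C
  left {C} C∈ = free₁ , free₂
    where
    free₁ : Crossing-free (x ∷ rightSpine r) C
    free₁ p<q q<r r<s _ (here refl) q∈ _  = <-asym q<r (proj₁ (chains-bounds pl C∈ q∈))
    free₁ p<q q<r r<s _ (there r∈)  _  s∈ =
      <⇒≱ (<-trans (proj₁ (spine-bounds pr r∈)) r<s) (proj₂ (chains-bounds pl C∈ s∈))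
    free₂ : Crossing-free C (x ∷ rightSpine r)
    free₂ p<q q<r r<s p∈ _  (here refl) _ = <-asym p<q (proj₁ (chains-bounds pl C∈ p∈))
    free₂ p<q q<r r<s _  r∈ (there q∈)  _ =
      <⇒≱ (<-trans (proj₁ (spine-bounds pr q∈)) q<r) (proj₂ (chains-bounds pl C∈ r∈))
  right : ∀ {b r} → Preorder c r b → All (Separate (suc a ∷ rightSpine r)) (chainsBelow r)
  right leaf = []
  right {r = node l′ y r′} pr@(node _ _) = All.tabulate λ {C} C∈ →
    let y<_ : ∀ {p} → p ∈ letters C → y < p
        y<_ = λ p∈ → proj₁ (chainsBelow-bounds pr C∈ p∈)
        x<_ : ∀ {p} → p ∈ letters C → suc a < p
        x<_ = λ p∈ → <-trans (s≤s (preorder-≤ pl)) (y< p∈)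
        free₁ : Crossing-free (suc a ∷ y ∷ rightSpine r′) C
        free₁ = λ
          { p<q q<r r<s _           (here refl) q∈ s∈ → <-asym q<r (x< q∈)
          -- The root x may be exchanged for y, which is on the spine and still below q.
          ; p<q q<r r<s (here refl) (there r∈)  q∈ s∈ →
              proj₁ (All.lookup (root-separate pr) C∈) (y< q∈) q<r r<s (here refl) r∈ q∈ s∈
          ; p<q q<r r<s (there p∈)  (there r∈)  q∈ s∈ →
              proj₁ (All.lookup (root-separate pr) C∈) p<q q<r r<s p∈ r∈ q∈ s∈
          }
        free₂ : Crossing-free C (suc a ∷ y ∷ rightSpine r′)
        free₂ = λ
          { p<q q<r r<s p∈ r∈ (here refl) _           → <-asym p<q (x< p∈)
          ; p<q q<r r<s p∈ r∈ (there _)   (here refl) → <-asym r<s (x< r∈)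
          ; p<q q<r r<s p∈ r∈ (there q∈)  (there s∈)  →
              proj₂ (All.lookup (root-separate pr) C∈) p<q q<r r<s p∈ r∈ q∈ s∈
          }
    in free₁ , free₂

chainsBelow-separate leaf = []
chainsBelow-separate (node pl pr) = AllPairs.++⁺ (chains-separate pl) (chainsBelow-separate pr)
  (All.tabulate λ B∈ → All.tabulate λ C∈ →
    let low  = λ {p} p∈ → proj₂ (chains-bounds {p = p} pl B∈ p∈)
        high = λ {p} p∈ → <-trans (n<1+n _) (proj₁ (chainsBelow-bounds {p = p} pr C∈ p∈))
    in (λ p<q q<r r<s p∈ r∈ q∈ s∈ → <⇒≱ (<-trans (high q∈) q<r) (low r∈))
     , (λ p<q q<r r<s p∈ r∈ q∈ s∈ → <⇒≱ (<-trans (high p∈) p<q) (low q∈)))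

word-reverse : ∀ π → word (reverse π) ↭ word π
word-reverse π = concatMap⁺ (↭-reverse π)
  where
  concatMap⁺ : ∀ {π ρ} → π ↭ ρ → word π ↭ word ρ
  concatMap⁺ ↭.refl                     = ↭-refl
  concatMap⁺ (↭.prep b p)               = ++⁺ˡ (letters b) (concatMap⁺ p)
  concatMap⁺ (↭.swap b c p)             = ↭-trans (shifts (letters b) (letters c)) (++⁺ˡ (letters c) (++⁺ˡ (letters b) (concatMap⁺ p)))
  concatMap⁺ (↭.trans p q)              = ↭-trans (concatMap⁺ p) (concatMap⁺ q)

chains-NCP : ∀ {n t} → Preorder 0 t n → NCP n (reverse (chains t))
chains-NCP {t = t} pt = mkNCP
  (↭-trans (word-reverse (chains t)) (↭-trans (word-chains t) (Enumerates⇒↭ (preorder-Enumerates pt))))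
  (All.tabulate (λ b∈ → All.lookup (chains-increasing pt) (Any.reverse⁻ b∈)))
  (AllPairs-reverse (chains-canonical pt))
  (AllPairs-reverse (AllPairs.map Separate-sym (chains-separate pt)))

-- Sorting gives weakly decreasing minima; their distinctness makes the order strict, and a strictly
-- ordered list is determined by its members.
sort-canonical : ∀ {π} → AllPairs MinB< π → Sort.sort decreasingMinima π ≡ reverse π
sort-canonical {π} π↗ = sorted-unique {R = flip MinB<} (λ p q → <-asym p q) strict (AllPairs-reverse π↗)
  (λ b∈ → Any.reverse⁺ (∈-resp-↭ (sort-↭ π) b∈))
  (λ b∈ → ∈-resp-↭ (↭-sym (sort-↭ π)) (Any.reverse⁻ b∈))
  where
  open Sort decreasingMinima using (sort; sort-↭; sort-↗)
  weak : AllPairs (λ B C → minB C ≤ minB B) (sort π)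
  weak = Linked⇒AllPairs (λ {B} {C} {D} p q → ≤-trans q p) (sort-↗ π)
  distinct : AllPairs (λ B C → minB B ≢ minB C) (sort π)
  distinct = AllPairs-resp-↭ (λ p q → p (sym q)) (↭-sym (sort-↭ π)) (AllPairs.map <⇒≢ π↗)
  strict : AllPairs (flip MinB<) (sort π)
  strict = AllPairs.zipWith (λ (C≤B , B≢C) → ≤∧≢⇒< C≤B (B≢C ∘ sym)) (weak , distinct)

ψ-preorder : ∀ {a b t} → Preorder a t b → ψ t ≡ reverse (chains t)
ψ-preorder pt = sort-canonical (chains-canonical pt)

++-split-unique : ∀ {A : Set} {P : A → Set} {xs xs′ ys ys′ : List A} →
  All P xs → All P xs′ → All (¬_ ∘ P) ys → All (¬_ ∘ P) ys′ → xs ++ ys ≡ xs′ ++ ys′ → xs ≡ xs′ × ys ≡ ys′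
++-split-unique []       []       _        _        eq   = refl , eq
++-split-unique []       (p ∷ _)  (¬p ∷ _) _        refl = contradiction p ¬p
++-split-unique (p ∷ _)  []       _        (¬p ∷ _) refl = contradiction p ¬p
++-split-unique (_ ∷ ps) (_ ∷ qs) ¬ps      ¬qs      eq
  with ∷-injectiveˡ eq | ++-split-unique ps qs ¬ps ¬qs (∷-injectiveʳ eq)
... | refl | refl , refl = refl , refl

-- When the right child is present its label, read off the root chain, tells the two parts of chainsBelow apart.
chains-node-injective : ∀ {a b c a′ b′ c′ x x′ l l′ r r′} →
  Preorder a l c → Preorder c r b → Preorder a′ l′ c′ → Preorder c′ r′ b′ →
  chains (node l x r) ≡ chains (node l′ x′ r′) → chains l ≡ chains l′ × x ≡ x′ × chains r ≡ chains r′
chains-node-injective {l = l} {l′} pl leaf pl′ leaf eq =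
  trans (sym (++-identityʳ (chains l))) (trans (∷-injectiveʳ eq) (++-identityʳ (chains l′)))
  , cong List⁺.head (∷-injectiveˡ eq) , refl
chains-node-injective pl leaf pl′ (node _ _) eq = case cong List⁺.tail (∷-injectiveˡ eq) of λ ()
chains-node-injective pl (node _ _) pl′ leaf eq = case cong List⁺.tail (∷-injectiveˡ eq) of λ ()
chains-node-injective {c = c} pl pr@(node _ _) pl′ pr′@(node _ _) eq
  with cong List⁺.tail (∷-injectiveˡ eq)
... | spine≡
  with refl ← ∷-injectiveˡ spine≡
  with ++-split-unique {P = λ B → List⁺.head B ≤ c}
         (All.tabulate (λ B∈ → proj₂ (chains-bounds pl B∈ (here refl))))
         (All.tabulate (λ B∈ → proj₂ (chains-bounds pl′ B∈ (here refl))))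
         (All.tabulate (λ B∈ → <⇒≱ (<-trans (n<1+n c) (proj₁ (chainsBelow-bounds pr B∈ (here refl))))))
         (All.tabulate (λ B∈ → <⇒≱ (<-trans (n<1+n c) (proj₁ (chainsBelow-bounds pr′ B∈ (here refl))))))
         (∷-injectiveʳ eq)
... | eql , eqr = eql , cong List⁺.head (∷-injectiveˡ eq) , cong₂ (λ s Bs → (suc c ∷ s) ∷ Bs) (∷-injectiveʳ spine≡) eqr

chains-injective : ∀ {a b a′ b′ t t′} → Preorder a t b → Preorder a′ t′ b′ → chains t ≡ chains t′ → t ≡ t′
chains-injective leaf leaf _ = refl
chains-injective (node {a} {l = l} {r} pl pr) (node {l = l′} {r = r′} pl′ pr′) eq
  with chains-node-injective pl pr pl′ pr′ eq
... | eql , refl , eqr = cong₂ (λ l r → node l (suc a) r) (chains-injective pl pl′ eql) (chains-injective pr pr′ eqr)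

-- The complementary tree.

snocSpine : BinTree → ℕ → BinTree
snocSpine (leaf _)     y = node (leaf tt) y (leaf tt)
snocSpine (node l x r) y = node l x (snocSpine r y)

-- s becomes the left subtree of the node of t that is last in preorder.
graft : BinTree → BinTree → BinTree
graft (leaf _)                  s = s
graft (node l x r@(leaf _))     s = node (graft l s) x r
graft (node l x r@(node _ _ _)) s = node l x (graft r s)

kreweras : (ℕ → ℕ) → BinTree → BinTree
kreweras f (leaf _)     = leaf tt
kreweras f (node l x r) = graft (kreweras f r) (snocSpine (kreweras f l) (f x))

preorder-snocSpine : ∀ {a b t} → Preorder a t b → Preorder a (snocSpine t (suc b)) (suc b)
preorder-snocSpine leaf         = node leaf leaf
preorder-snocSpine (node pl pr) = node pl (preorder-snocSpine pr)

preorder-graft : ∀ {a b c t s} → Preorder a t b → Preorder b s c → Preorder a (graft t s) c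
preorder-graft leaf                     ps = ps
preorder-graft (node pl leaf)           ps = node (preorder-graft pl ps) leaf
preorder-graft (node pl pr@(node _ _)) ps = node pl (preorder-graft pr ps)

-- Bar reverses the order: labels from r come first and fill (n - b, n - c], those from l follow up
-- to n - a - 1, and the root becomes n - a, the last. Appending to the spine and grafting insert
-- them in just this order.
preorder-kreweras : ∀ {n a b t} → Preorder a t b → b ≤ n → Preorder (n ∸ b) (kreweras (suc n ∸_) t) (n ∸ a)
preorder-kreweras leaf _ = leaf
preorder-kreweras {n} {a} {b} (node {c = c} {l} pl pr) b≤n = preorder-graft (preorder-kreweras pr b≤n)
  -- Truncation is harmless: a < n makes n ∸ a the successor of n ∸ (a + 1).
  (subst (λ d → Preorder (n ∸ c) (snocSpine (kreweras (suc n ∸_) l) d) d) (sym (+-∸-assoc 1 a<n))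
    (preorder-snocSpine (preorder-kreweras pl (≤-trans (preorder-≤ pr) b≤n))))
  where
  a<n : suc a ≤ n
  a<n = ≤-trans (preorder-≤ pl) (≤-trans (preorder-≤ pr) b≤n)

appendHead : ℕ → Blocks → Blocks
appendHead y []       = List⁺.[ y ] ∷ []
appendHead y (b ∷ bs) = (b List⁺.⁺∷ʳ y) ∷ bs

rightSpine-snocSpine : ∀ t y → rightSpine (snocSpine t y) ≡ rightSpine t ++ y ∷ []
rightSpine-snocSpine (leaf _)     y = refl
rightSpine-snocSpine (node l x r) y = cong (x ∷_) (rightSpine-snocSpine r y)

chainsBelow-snocSpine : ∀ t y → chainsBelow (snocSpine t y) ≡ chainsBelow t
chainsBelow-snocSpine (leaf _)     y = refl
chainsBelow-snocSpine (node l x r) y = cong (chains l ++_) (chainsBelow-snocSpine r y)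

chains-snocSpine : ∀ t y → chains (snocSpine t y) ≡ appendHead y (chains t)
chains-snocSpine (leaf _)     y = refl
chains-snocSpine (node l x r) y = cong₂ (λ s Bs → (x ∷ s) ∷ chains l ++ Bs)
  (rightSpine-snocSpine r y) (chainsBelow-snocSpine r y)

rightSpine-graft : ∀ l x r s → rightSpine (graft (node l x r) s) ≡ rightSpine (node l x r)
rightSpine-graft l x (leaf _)        s = refl
rightSpine-graft l x (node l′ x′ r′) s = cong (x ∷_) (rightSpine-graft l′ x′ r′ s)

-- A left child opens a new chain, so no chain of t changes; as the host is last in preorder, the
-- chains of s come after all those of t.
chains-graft      : ∀ t s → chains (graft t s) ≡ chains t ++ chains s
chainsBelow-graft : ∀ l x r s → chainsBelow (graft (node l x r) s) ≡ chainsBelow (node l x r) ++ chains s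

chains-graft (leaf _)                         s = refl
chains-graft (node l x r@(leaf _))            s = cong ((x ∷ []) ∷_) (chainsBelow-graft l x r s)
chains-graft (node l x r@(node l′ x′ r′)) s =
  cong₂ (λ sp Bs → (x ∷ sp) ∷ Bs) (rightSpine-graft l′ x′ r′ s) (chainsBelow-graft l x r s)

chainsBelow-graft l x (leaf _) s = begin
  chains (graft l s) ++ []         ≡⟨ ++-identityʳ _ ⟩
  chains (graft l s)               ≡⟨ chains-graft l s ⟩
  chains l ++ chains s             ≡⟨ cong (_++ chains s) (++-identityʳ (chains l)) ⟨
  (chains l ++ []) ++ chains s     ∎
  where open ≡-Reasoning
chainsBelow-graft l x r@(node l′ x′ r′) s = trans
  (cong (chains l ++_) (chainsBelow-graft l′ x′ r′ s))
  (sym (++-assoc (chains l) (chainsBelow r) (chains s)))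

-- The maximal descending runs of the in-order word of a preorder-labelled tree, the last run first.
runs : BinTree → Blocks
runs (leaf _)     = []
runs (node l x r) = runs r ++ appendHead x (runs l)

appendHead-map : ∀ (f : ℕ → ℕ) y bs →
  appendHead (f y) (map (List⁺.map f) bs) ≡ map (List⁺.map f) (appendHead y bs)
appendHead-map f y []              = refl
appendHead-map f y ((x ∷ xs) ∷ bs) = cong (λ zs → (f x ∷ zs) ∷ map (List⁺.map f) bs)
  (sym (List.map-++ f xs (y ∷ [])))

-- Both recursions agree: `snocSpine` acts on chains as `appendHead`, and `graft` as concatenation.
chains-kreweras : ∀ f t → chains (kreweras f t) ≡ map (List⁺.map f) (runs t)
chains-kreweras f (leaf _)     = refl
chains-kreweras f (node l x r) = begin
  chains (graft (kreweras f r) (snocSpine (kreweras f l) (f x)))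
    ≡⟨ chains-graft (kreweras f r) _ ⟩
  chains (kreweras f r) ++ chains (snocSpine (kreweras f l) (f x))
    ≡⟨ cong₂ _++_ (chains-kreweras f r)
         (trans (chains-snocSpine (kreweras f l) (f x)) (cong (appendHead (f x)) (chains-kreweras f l))) ⟩
  map (List⁺.map f) (runs r) ++ appendHead (f x) (map (List⁺.map f) (runs l))
    ≡⟨ cong (map (List⁺.map f) (runs r) ++_) (appendHead-map f x (runs l)) ⟩
  map (List⁺.map f) (runs r) ++ map (List⁺.map f) (appendHead x (runs l))
    ≡⟨ List.map-++ (List⁺.map f) (runs r) _ ⟨
  map (List⁺.map f) (runs r ++ appendHead x (runs l)) ∎
  where open ≡-Reasoning

-- Slashes in the barred word.

appendLast : Blocks → ℕ → Blocks
appendLast []           y = List⁺.[ y ] ∷ []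
appendLast (b ∷ [])     y = (b List⁺.⁺∷ʳ y) ∷ []
appendLast (b ∷ c ∷ bs) y = b ∷ appendLast (c ∷ bs) y

appendLast-∷ʳ : ∀ bs b y → appendLast (bs ++ b ∷ []) y ≡ bs ++ (b List⁺.⁺∷ʳ y) ∷ []
appendLast-∷ʳ []           b y = refl
appendLast-∷ʳ (c ∷ [])     b y = refl
appendLast-∷ʳ (c ∷ d ∷ bs) b y = cong (c ∷_) (appendLast-∷ʳ (d ∷ bs) b y)

appendLast-reverse : ∀ bs y → appendLast (reverse bs) y ≡ reverse (appendHead y bs)
appendLast-reverse []       y = refl
appendLast-reverse (b ∷ bs) y = trans (cong (λ cs → appendLast cs y) (List.unfold-reverse b bs))
  (trans (appendLast-∷ʳ (reverse bs) b y) (sym (List.unfold-reverse (b List⁺.⁺∷ʳ y) bs)))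

-- `prependLetter` looks only at the first head. It meets y only when `bs` is empty, and there x < y
-- joins the two.
prepend-appendLast : ∀ {x y} bs S → x < y →
  prependLetter x (appendLast bs y ++ S) ≡ appendLast (prependLetter x bs) y ++ S
prepend-appendLast []                    S x<y = prepend-< _ S x<y
prepend-appendLast {x} {y} (b@(z ∷ zs) ∷ []) S x<y with prependLetter x (b ∷ []) | prepend-cases x b []
... | _ | inj₁ (x<z , refl) = prepend-< (b List⁺.⁺∷ʳ y) S x<z
... | _ | inj₂ (x≮z , refl) = prepend-≮ (b List⁺.⁺∷ʳ y) S x≮z
prepend-appendLast {x} {y} (b ∷ c ∷ bs)      S x<y with prependLetter x (b ∷ c ∷ bs) | prepend-cases x b (c ∷ bs)
... | _ | inj₁ (x<h , refl) = prepend-< b (appendLast (c ∷ bs) y ++ S) x<h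
... | _ | inj₂ (x≮h , refl) = prepend-≮ b (appendLast (c ∷ bs) y ++ S) x≮h

slash-++-max : ∀ {y} u S → All (_< y) u → foldr prependLetter (List⁺.[ y ] ∷ S) u ≡ appendLast (slash u) y ++ S
slash-++-max []      S []          = refl
slash-++-max (x ∷ u) S (x<y ∷ u<y) = trans (cong (prependLetter x) (slash-++-max u S u<y))
  (prepend-appendLast (slash u) S x<y)

slash-max-∷ : ∀ {y} w → All (_< y) w → slash (y ∷ w) ≡ List⁺.[ y ] ∷ slash w
slash-max-∷ {y} w w<y with slash w | word-slash w
... | []     | _    = refl
... | b ∷ bs | refl = prepend-≮ b bs (<-asym (All.lookup w<y (here refl)))

-- The root, least before, becomes the largest letter: it joins the last block coming from l, and a
-- slash must follow it.
slash-antitone : ∀ {a b t} (f : ℕ → ℕ) → Preorder a t b → (∀ {p q} → a < p → p < q → q ≤ b → f q < f p) →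
  slash (map f (Infix.toList t)) ≡ reverse (map (List⁺.map f) (runs t))
slash-antitone f leaf _ = refl
slash-antitone {a} {b} f (node {c = c} {l} {r} pl pr) antitone = begin
  slash (map f (Infix.toList (node l x r)))
    ≡⟨ cong slash (trans (cong (map f) (toList-node l x r)) (List.map-++ f (Infix.toList l) (x ∷ Infix.toList r))) ⟩
  slash (fl ++ f x ∷ fr)
    ≡⟨ List.foldr-++ prependLetter [] fl (f x ∷ fr) ⟩
  foldr prependLetter (slash (f x ∷ fr)) fl
    ≡⟨ cong (λ S → foldr prependLetter S fl) (slash-max-∷ fr (below-x r pr (preorder-≤ pl) ≤-refl)) ⟩
  foldr prependLetter (List⁺.[ f x ] ∷ slash fr) fl
    ≡⟨ slash-++-max fl (slash fr) (below-x l pl ≤-refl (preorder-≤ pr)) ⟩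
  appendLast (slash fl) (f x) ++ slash fr
    ≡⟨ cong₂ (λ u v → appendLast u (f x) ++ v)
         (slash-antitone f pl (λ x<p p<q q≤c → antitone (<-trans (n<1+n a) x<p) p<q (≤-trans q≤c (preorder-≤ pr))))
         (slash-antitone f pr (λ c<p → antitone (≤-<-trans (<⇒≤ (preorder-≤ pl)) c<p))) ⟩
  appendLast (reverse Rl) (f x) ++ reverse Rr
    ≡⟨ cong (_++ reverse Rr) (appendLast-reverse Rl (f x)) ⟩
  reverse (appendHead (f x) Rl) ++ reverse Rr
    ≡⟨ List.reverse-++ Rr (appendHead (f x) Rl) ⟨
  reverse (Rr ++ appendHead (f x) Rl)
    ≡⟨ cong (λ u → reverse (Rr ++ u)) (appendHead-map f x (runs l)) ⟩
  reverse (Rr ++ map (List⁺.map f) (appendHead x (runs l)))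
    ≡⟨ cong reverse (List.map-++ (List⁺.map f) (runs r) (appendHead x (runs l))) ⟨
  reverse (map (List⁺.map f) (runs r ++ appendHead x (runs l))) ∎
  where
  open ≡-Reasoning
  x  = suc a
  fl = map f (Infix.toList l)
  fr = map f (Infix.toList r)
  Rl = map (List⁺.map f) (runs l)
  Rr = map (List⁺.map f) (runs r)
  below-x : ∀ {c′ b′} t → Preorder c′ t b′ → x ≤ c′ → b′ ≤ b → All (_< f x) (map f (Infix.toList t))
  below-x t pt x≤c′ b′≤b = All.map⁺ (All.tabulate λ q∈ →
    let c′<q , q≤b′ = labels⁻ pt q∈ in antitone ≤-refl (≤-<-trans x≤c′ c′<q) (≤-trans q≤b′ b′≤b))

-- Descending runs against split chains.

Inside Outside : ℕ → ℕ → ℕ → Set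
Inside  k m p = k < p × p ≤ m
Outside k m p = p ≤ k ⊎ m < p

Unsplit Split : ℕ → ℕ → Block → Set
Unsplit k m B = All (Inside k m) (letters B) ⊎ All (Outside k m) (letters B)
Split   k m B = Any (Inside k m) (letters B) × Any (Outside k m) (letters B)

-- The head of `runs t` is the run closing the in-order word, the only one that a root placed to its
-- right can join.
InHead : ℕ → Blocks → Set
InHead p []      = ⊥
InHead p (b ∷ _) = p ∈ letters b

∈-∷ʳ⁻ : ∀ {p y} b → p ∈ letters (b List⁺.⁺∷ʳ y) → p ∈ letters b ⊎ p ≡ y
∈-∷ʳ⁻ (x ∷ xs) p∈ with ∈-++⁻ (x ∷ xs) p∈
... | inj₁ p∈b         = inj₁ p∈b
... | inj₂ (here refl) = inj₂ refl

InHead-appendHead⁻ : ∀ {p y} bs → InHead p (appendHead y bs) → InHead p bs ⊎ p ≡ y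
InHead-appendHead⁻ []       (here refl) = inj₂ refl
InHead-appendHead⁻ (b ∷ bs) p∈          = ∈-∷ʳ⁻ b p∈

InHead-appendHead⁺ : ∀ {p y} bs → InHead p bs → InHead p (appendHead y bs)
InHead-appendHead⁺ ((x ∷ xs) ∷ bs) p∈ = ∈-++⁺ˡ p∈

InHead-appended : ∀ {y} bs → InHead y (appendHead y bs)
InHead-appended []              = here refl
InHead-appended ((x ∷ xs) ∷ bs) = ∈-++⁺ʳ (x ∷ xs) (here refl)

InHead⇒SameBlock : ∀ {p q} bs → InHead p bs → InHead q bs → SameBlock bs p q
InHead⇒SameBlock (b ∷ bs) p∈ q∈ = here (p∈ , q∈)

InHead-++⁺ : ∀ {p} bs {cs} → InHead p bs → InHead p (bs ++ cs)
InHead-++⁺ (b ∷ bs) p∈ = p∈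

appendHead-nonempty : ∀ y bs → appendHead y bs ≢ []
appendHead-nonempty y []       ()
appendHead-nonempty y (b ∷ bs) ()

InHead-++⁻ : ∀ {p} bs {cs} → bs ≢ [] → InHead p (bs ++ cs) → InHead p bs
InHead-++⁻ []       bs≢[] _  = contradiction refl bs≢[]
InHead-++⁻ (b ∷ bs) _     p∈ = p∈

runs-nonempty : ∀ l x r → runs (node l x r) ≢ []
runs-nonempty l x r eq = appendHead-nonempty x (runs l) (List.++-conicalʳ (runs r) _ eq)

SameBlock-appendHead⁺ : ∀ {p q y} bs → SameBlock bs p q → SameBlock (appendHead y bs) p q
SameBlock-appendHead⁺ ((x ∷ xs) ∷ bs) (here (p∈ , q∈)) = here (∈-++⁺ˡ p∈ , ∈-++⁺ˡ q∈)
SameBlock-appendHead⁺ (b ∷ bs)        (there same)     = there same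

SameBlock-appendHead⁻ : ∀ {p q y} bs → SameBlock (appendHead y bs) p q →
  SameBlock bs p q ⊎ p ≡ y ⊎ (InHead p bs × q ≡ y)
SameBlock-appendHead⁻ []       (here (here refl , _)) = inj₂ (inj₁ refl)
SameBlock-appendHead⁻ (b ∷ bs) (there same) = inj₁ (there same)
SameBlock-appendHead⁻ (b ∷ bs) (here (p∈ , q∈)) with ∈-∷ʳ⁻ b p∈ | ∈-∷ʳ⁻ b q∈
... | inj₂ p≡y | _        = inj₂ (inj₁ p≡y)
... | inj₁ p∈b | inj₁ q∈b = inj₁ (here (p∈b , q∈b))
... | inj₁ p∈b | inj₂ q≡y = inj₂ (inj₂ (p∈b , q≡y))

SameBlock-refl : ∀ {π p} → p ∈ word π → SameBlock π p p
SameBlock-refl {π} p∈ = Any.map (λ p∈b → p∈b , p∈b) (∈-concatMap⁻ letters p∈)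

SameBlock-sym : ∀ {π p q} → SameBlock π p q → SameBlock π q p
SameBlock-sym = Any.map (λ (p∈ , q∈) → q∈ , p∈)

SameBlock⇒∈ : ∀ {π p q} → SameBlock π p q → p ∈ word π
SameBlock⇒∈ same = ∈-concatMap⁺ letters (Any.map proj₁ same)

InHead⇒∈ : ∀ {p} π → InHead p π → p ∈ word π
InHead⇒∈ (b ∷ π) p∈ = ∈-++⁺ˡ p∈

word-appendHead : ∀ y bs → word (appendHead y bs) ↭ y ∷ word bs
word-appendHead y []              = ↭-refl
word-appendHead y ((x ∷ xs) ∷ bs) = ↭-trans
  (↭-reflexive (++-assoc (x ∷ xs) (y ∷ []) (word bs))) (shift y (x ∷ xs) (word bs))

word-runs : ∀ t → word (runs t) ↭ Infix.toList t
word-runs (leaf _)     = ↭-refl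
word-runs (node l x r) = begin
  word (runs r ++ appendHead x (runs l))        ≡⟨ concatMap-++ letters (runs r) (appendHead x (runs l)) ⟩
  word (runs r) ++ word (appendHead x (runs l)) ↭⟨ ++⁺ (word-runs r)
                                                     (↭-trans (word-appendHead x (runs l)) (prep x (word-runs l))) ⟩
  Infix.toList r ++ x ∷ Infix.toList l          ↭⟨ ++-comm (Infix.toList r) (x ∷ Infix.toList l) ⟩
  x ∷ Infix.toList l ++ Infix.toList r          ↭⟨ shift x (Infix.toList l) (Infix.toList r) ⟨
  Infix.toList l ++ x ∷ Infix.toList r          ≡⟨ toList-node l x r ⟨
  Infix.toList (node l x r)                     ∎
  where open PermutationReasoning

runs-bounds : ∀ {a b t p} → Preorder a t b → p ∈ word (runs t) → a < p × p ≤ b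
runs-bounds {t = t} pt p∈ = labels⁻ pt (∈-resp-↭ (word-runs t) p∈)

¬Inside∧Outside : ∀ {k m p} → Inside k m p → Outside k m p → ⊥
¬Inside∧Outside (k<p , p≤m) (inj₁ p≤k) = <⇒≱ k<p p≤k
¬Inside∧Outside (k<p , p≤m) (inj₂ m<p) = <⇒≱ m<p p≤m

-- Only one chain changes: the root is put in front of the spine of r, which starts at c + 1. That
-- label being outside, its whole chain is.
unsplit-node : ∀ {k m a b c l r} → Preorder c r b → Outside k m (suc a) → Outside k m (suc c) →
  All (Unsplit k m) (chains l) → All (Unsplit k m) (chains r) → All (Unsplit k m) (chains (node l (suc a) r))
unsplit-node leaf x-out _ ul [] = inj₂ (x-out ∷ []) ∷ All.++⁺ ul []
unsplit-node (node _ _) x-out y-out ul (inj₁ (y-in ∷ _) ∷ urs) = contradiction y-out (¬Inside∧Outside y-in)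
unsplit-node (node _ _) x-out y-out ul (inj₂ out        ∷ urs) = inj₂ (x-out ∷ out) ∷ All.++⁺ ul urs

chains-uniform : ∀ {a b t} {P : Block → Set} {Q : ℕ → Set} → (∀ {B} → All Q (letters B) → P B) →
  Preorder a t b → (∀ {p} → a < p → p ≤ b → Q p) → All P (chains t)
chains-uniform f pt q = All.tabulate λ B∈ → f (All.tabulate λ p∈ → uncurry q (chains-bounds pt B∈ p∈))

-- Inside the labels x + 1, …, c, the intervals (x, m] and (m, c] are complementary.
complement-unsplit : ∀ {x m c t} → Preorder x t c → m ≤ c →
  All (Unsplit m c) (chains t) → All (Unsplit x m) (chains t)
complement-unsplit {x} {m} {c} pt m≤c us = All.tabulate λ {B} B∈ → flip-block B∈ (All.lookup us B∈)
  where
  flip-block : ∀ {B} → B ∈ chains _ → Unsplit m c B → Unsplit x m B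
  flip-block B∈ (inj₁ ins) = inj₂ (All.map (inj₂ ∘ proj₁) ins)
  flip-block B∈ (inj₂ out) = inj₁ (All.tabulate λ p∈ →
    let x<p , p≤c = chains-bounds pt B∈ p∈ in
    x<p , [ id , (λ c<p → contradiction p≤c (<⇒≱ c<p)) ]′ (All.lookup out p∈))

complement-split : ∀ {x m c t} → Preorder x t c → Any (Split m c) (chains t) → Any (Split x m) (chains t)
complement-split {x} {m} {c} {t} pt s with find s
... | B , B∈ , ins , out with find ins | find out
...   | p , p∈ , m<p , _ | q , q∈ , q-out = lose B∈
  ( lose q∈ (let x<q , q≤c = chains-bounds pt B∈ q∈ in
      x<q , [ id , (λ c<q → contradiction q≤c (<⇒≱ c<q)) ]′ q-out)
  , lose p∈ (inj₂ m<p))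

-- The companion statement for a root that joins the last run. If r is nonempty, the last run lies
-- in r and everything up to c is outside; if r is empty, m is the root or in the last run of l.
head⇒unsplit : ∀ {a b t m} → Preorder a t b → InHead m (runs t) → All (Unsplit m b) (chains t)
head⇒unsplit {t = node l x (leaf _)} (node {b = b} pl leaf) m∈ with InHead-appendHead⁻ (runs l) m∈
... | inj₂ refl = unsplit-node {r = leaf tt} leaf (inj₁ ≤-refl) (inj₂ (n<1+n b)) (chains-uniform inj₁ pl _,_) []
... | inj₁ m∈l  = unsplit-node {r = leaf tt} leaf
      (inj₁ (<⇒≤ (proj₁ (runs-bounds pl (InHead⇒∈ (runs l) m∈l))))) (inj₂ (n<1+n b)) (head⇒unsplit pl m∈l) []
head⇒unsplit {t = node l x r@(node l′ y r′)} (node {c = c} pl pr@(node _ _)) m∈ =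
  unsplit-node pr (inj₁ (≤-trans (preorder-≤ pl) (<⇒≤ c<m))) (inj₁ c<m)
    (chains-uniform inj₂ pl (λ _ p≤c → inj₁ (≤-trans p≤c (<⇒≤ c<m)))) (head⇒unsplit pr m∈r)
  where
  m∈r : InHead _ (runs r)
  m∈r = InHead-++⁻ (runs r) (runs-nonempty l′ y r′) m∈
  c<m = proj₁ (runs-bounds pr (InHead⇒∈ (runs r) m∈r))

-- A run lies either in r, with the root and l outside (k, m], or among the root and l, with r
-- outside; the recursion enters that one subtree.
same⇒unsplit : ∀ {a b t k m} → Preorder a t b → k < m → SameBlock (runs t) k m → All (Unsplit k m) (chains t)
same⇒unsplit leaf _ ()
same⇒unsplit {t = node l x r} {k} {m} (node {c = c} pl pr) k<m same with Any.++⁻ (runs r) same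
... | inj₁ same-r = unsplit-node pr (inj₁ (≤-trans (preorder-≤ pl) (<⇒≤ c<k))) (inj₁ c<k)
        (chains-uniform inj₂ pl (λ _ p≤c → inj₁ (≤-trans p≤c (<⇒≤ c<k)))) (same⇒unsplit pr k<m same-r)
  where c<k = proj₁ (runs-bounds pr (SameBlock⇒∈ same-r))
... | inj₂ same-l = unsplit-node pr (inj₁ x≤k) (inj₂ (s≤s m≤c)) unsplit-l
        (chains-uniform inj₂ pr (λ c<p _ → inj₂ (≤-<-trans m≤c c<p)))
  where
  bounds : ∀ {p q} → SameBlock (appendHead x (runs l)) p q → x ≤ p × p ≤ c
  bounds s with ∈-resp-↭ (word-appendHead x (runs l)) (SameBlock⇒∈ s)
  ... | here refl = ≤-refl , preorder-≤ pl
  ... | there p∈  = let x<p , p≤c = runs-bounds pl p∈ in <⇒≤ x<p , p≤c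
  x≤k : x ≤ k
  x≤k = proj₁ (bounds same-l)
  m≤c : m ≤ c
  m≤c = proj₂ (bounds (SameBlock-sym same-l))
  unsplit-l : All (Unsplit k m) (chains l)
  unsplit-l with SameBlock-appendHead⁻ (runs l) (SameBlock-sym same-l)
  ... | inj₁ same′ = same⇒unsplit pl k<m (SameBlock-sym same′)
  ... | inj₂ (inj₁ refl) = contradiction k<m (≤⇒≯ x≤k)
  -- Here k is the root, so m is in the last run of l.
  ... | inj₂ (inj₂ (m∈ , refl)) = complement-unsplit pl m≤c (head⇒unsplit pl m∈)

split-left : ∀ {k m l x r} → Any (Split k m) (chains l) → Any (Split k m) (chains (node l x r))
split-left = there ∘ Any.++⁺ˡ

split-right : ∀ {k m l x r} → Any (Split k m) (chains r) → Any (Split k m) (chains (node l x r))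
split-right {r = node _ _ _} (here (ins , out)) = here (there ins , there out)
split-right {l = l} {r = node _ _ _} (there s)  = there (Any.++⁺ʳ (chains l) s)

-- For c < b the right child exists and has label c + 1, so the root chain contains both a + 1 and c
-- + 1.
root-split : ∀ {k m a b c l r} → Preorder c r b → c < b → Outside k m (suc a) → Inside k m (suc c) →
  Any (Split k m) (chains (node l (suc a) r))
root-split leaf       c<c _     _    = contradiction c<c (<-irrefl refl)
root-split (node _ _) _   x-out y-in = here (there (here y-in) , here x-out)

-- Converse of `head⇒unsplit`, as an alternative so that a failure exhibits the chain that will
-- separate the points. If r is nonempty and m ≤ c, the root chain is split.
head-or-split : ∀ {a b t m} → Preorder a t b → a < m → m ≤ b → InHead m (runs t) ⊎ Any (Split m b) (chains t)
head-or-split leaf a<m m≤a = contradiction a<m (≤⇒≯ m≤a)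
head-or-split {t = node l x r} {m} (node {b = b} {c} pl pr) a<m m≤b with ≤-<-connex m c
... | inj₂ c<m = [ inj₁ ∘ InHead-++⁺ (runs r) , inj₂ ∘ split-right ]′ (head-or-split pr c<m m≤b)
... | inj₁ m≤c with m≤n⇒m<n∨m≡n (preorder-≤ pr)
...   | inj₁ c<b = inj₂ (root-split pr c<b (inj₁ a<m) (s≤s m≤c , c<b))
...   | inj₂ refl with pr | m≤n⇒m<n∨m≡n a<m
...     | node pl′ pr′ | _ = contradiction (≤-trans (preorder-≤ pl′) (preorder-≤ pr′)) (<-irrefl refl)
...     | leaf | inj₂ refl = inj₁ (InHead-appended (runs l))
...     | leaf | inj₁ x<m  = [ inj₁ ∘ InHead-appendHead⁺ (runs l) , inj₂ ∘ split-left ]′ (head-or-split pl x<m m≤c)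

same-or-split : ∀ {a b t k m} → Preorder a t b → a < k → k < m → m ≤ b →
  SameBlock (runs t) k m ⊎ Any (Split k m) (chains t)
same-or-split leaf a<k k<m m≤a = contradiction (<-trans a<k k<m) (≤⇒≯ m≤a)
same-or-split {t = node l x r} {k} {m} (node {a} {b} {c} pl pr) a<k k<m m≤b
  with ≤-<-connex k c | ≤-<-connex m c | m≤n⇒m<n∨m≡n a<k
... | inj₂ c<k | _        | _        = [ inj₁ ∘ Any.++⁺ˡ , inj₂ ∘ split-right ]′ (same-or-split pr c<k k<m m≤b)
-- The root is at most k, while the right child c + 1 lies in (k, m].
... | inj₁ k≤c | inj₂ c<m | _        = inj₂ (root-split pr (<-≤-trans c<m m≤b) (inj₁ a<k) (s≤s k≤c , c<m))
... | inj₁ _   | inj₁ m≤c | inj₁ x<k =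
  [ inj₁ ∘ Any.++⁺ʳ (runs r) ∘ SameBlock-appendHead⁺ (runs l) , inj₂ ∘ split-left ]′ (same-or-split pl x<k k<m m≤c)
... | inj₁ _   | inj₁ m≤c | inj₂ refl =
  [ (λ m∈ → inj₁ (Any.++⁺ʳ (runs r) (InHead⇒SameBlock (appendHead x (runs l))
      (InHead-appended (runs l)) (InHead-appendHead⁺ (runs l) m∈))))
  , inj₂ ∘ split-left ∘ complement-split pl ]′ (head-or-split pl k<m m≤c)

-- Half-points, hulls and regions.

-- The primed point between k and k + 1.
halfPoint : ℕ → Point
halfPoint k = circlePoint (suc (2 * k))

primed-halfPoint : ∀ n {i} → i ≤ n → primed n i ≡ halfPoint (suc n ∸ i)
primed-halfPoint n {i} i≤n = cong circlePoint (begin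
  2 * n + 3 ∸ 2 * i          ≡⟨ cong (_∸ 2 * i) (trans (+-comm (2 * n) 3) (cong suc (sym (*-suc 2 n)))) ⟩
  suc (2 * suc n) ∸ 2 * i    ≡⟨ +-∸-assoc 1 (*-monoʳ-≤ 2 (m≤n⇒m≤1+n i≤n)) ⟩
  suc (2 * suc n ∸ 2 * i)    ≡⟨ cong suc (*-distribˡ-∸ 2 (suc n) i) ⟨
  suc (2 * (suc n ∸ i))      ∎)
  where open ≡-Reasoning

-- Labels have even and half-points odd parameters, so all comparisons are strict; k < p and p ≤ m
-- mirror the two ends of (k, m].
odd<even : ∀ {k p} → k < p → suc (2 * k) < 2 * p
odd<even {k} {p} k<p = subst (_≤ 2 * p) (*-suc 2 k) (*-monoʳ-≤ 2 k<p)

even<odd : ∀ {p m} → p ≤ m → 2 * p < suc (2 * m)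
even<odd p≤m = s≤s (*-monoʳ-≤ 2 p≤m)

odd<odd : ∀ {k m} → k < m → suc (2 * k) < suc (2 * m)
odd<odd k<m = s≤s (*-monoʳ-< 2 k<m)

det-rotate-pos : ∀ P Q R → 0ℚ ℚ.< det P Q R → 0ℚ ℚ.< det Q R P
det-rotate-pos P Q R = subst (0ℚ ℚ.<_) (det-rotate P Q R)

det-swap-neg : ∀ P Q R → 0ℚ ℚ.< det P Q R → ¬ 0ℚ ℚ.< det Q P R
det-swap-neg P Q R 0<PQR 0<QPR = opposite (det P Q R) 0<PQR (subst (0ℚ ℚ.<_) (det-swap P Q R) 0<QPR)
  where
  opposite : ∀ d → 0ℚ ℚ.< d → ¬ 0ℚ ℚ.< 0ℚ ℚ.- d
  opposite d 0<d 0<-d = ℚ.<-asym 0<d (0<-⇒< 0<-d)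

inside-sign : ∀ {k m p} → Inside k m p → 0ℚ ℚ.< det (halfPoint m) (halfPoint k) (unprimed p)
inside-sign {k} {m} {p} (k<p , p≤m) = det-rotate-pos (unprimed p) (halfPoint m) (halfPoint k)
  (det-rotate-pos (halfPoint k) (unprimed p) (halfPoint m) (det-increasing (odd<even k<p) (even<odd p≤m)))

-- Lying before k or after m gives the same cyclic order k, m, p, hence the same sign.
outside-sign : ∀ {k m p} → k < m → Outside k m p → 0ℚ ℚ.< det (halfPoint k) (halfPoint m) (unprimed p)
outside-sign {k} {m} {p} k<m (inj₁ p≤k) = det-rotate-pos (unprimed p) (halfPoint k) (halfPoint m)
  (det-increasing (even<odd p≤k) (odd<odd k<m))
outside-sign k<m (inj₂ m<p) = det-increasing (odd<odd k<m) (odd<even m<p)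

unsplit⇒one-sided : ∀ {k m B} → k < m → Unsplit k m B → OneSided (halfPoint k) (halfPoint m) B
unsplit⇒one-sided k<m (inj₁ ins) = inj₂ (All.map inside-sign ins)
unsplit⇒one-sided k<m (inj₂ out) = inj₁ (All.map (outside-sign k<m) out)

unsplit⇒free : ∀ {k m π} → k < m → All (Unsplit k m) π → SegmentInComplement π (halfPoint k) (halfPoint m)
unsplit⇒free {k} {m} k<m us = chord-free (suc (2 * k)) (suc (2 * m)) (All.map (unsplit⇒one-sided k<m) us)

-- In both cases the cyclic order is q, k, p, m: the chord p q has the two half-points on opposite
-- sides.
split-signs : ∀ {k m p q} → Inside k m p → Outside k m q →
  0ℚ ℚ.< det (unprimed p) (unprimed q) (halfPoint k) × 0ℚ ℚ.< det (unprimed q) (unprimed p) (halfPoint m)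
split-signs {k} {m} {p} {q} (k<p , p≤m) (inj₁ q≤k) =
    det-rotate-pos K P′ Q (det-rotate-pos Q K P′ (det-increasing (even<odd q≤k) (odd<even k<p)))
  , det-increasing (*-monoʳ-< 2 (≤-<-trans q≤k k<p)) (even<odd p≤m)
  where K = halfPoint k ; P′ = unprimed p ; Q = unprimed q
split-signs {k} {m} {p} {q} (k<p , p≤m) (inj₂ m<q) =
    det-rotate-pos K P′ Q (det-increasing (odd<even k<p) (*-monoʳ-< 2 (≤-<-trans p≤m m<q)))
  , det-rotate-pos M Q P′ (det-rotate-pos P′ M Q (det-increasing (even<odd p≤m) (odd<even m<q)))
  where K = halfPoint k ; M = halfPoint m ; P′ = unprimed p ; Q = unprimed q

-- A path would carry the sign of its first endpoint to the other, where it is the opposite one.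
split⇒disconnected : ∀ {k m π} → All IncreasingBlock π → Any (Split k m) π →
  ¬ SameRegion π (halfPoint k) (halfPoint m) × ¬ SameRegion π (halfPoint m) (halfPoint k)
split⇒disconnected {k} {m} {π} π↗ split =
  let B , B∈ , ins , out = find split
      p , p∈ , p-in      = find ins
      q , q∈ , q-out     = find out
      B!                 = increasing⇒Unique B (All.lookup π↗ B∈)
      0<pqk , 0<qpm      = split-signs p-in q-out
      P = unprimed p
      Q = unprimed q
  in (λ path → det-swap-neg P Q (halfPoint m) (side-preserved {b = B} B∈ B! p∈ q∈ path 0<pqk) 0<qpm)
   , (λ path → det-swap-neg Q P (halfPoint k) (side-preserved {b = B} B∈ B! q∈ p∈ path 0<qpm) 0<pqk)

All-reverse : ∀ {P : Block → Set} {π} → All P π → All P (reverse π)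
All-reverse pπ = All.tabulate (All.lookup pπ ∘ Any.reverse⁻)

-- Shaped to serve k > m as well: a single segment is easily reversed, and a path is accepted in
-- either direction.
runs⇔regions-< : ∀ {n t k m} → Preorder 0 t n → 0 < k → k < m → m ≤ n →
  let σ = reverse (chains t) in
  (SameBlock (runs t) k m → SegmentInComplement σ (halfPoint k) (halfPoint m))
  × (SameRegion σ (halfPoint k) (halfPoint m) ⊎ SameRegion σ (halfPoint m) (halfPoint k) → SameBlock (runs t) k m)
runs⇔regions-< pt 0<k k<m m≤n = (λ same → unsplit⇒free k<m (All-reverse (same⇒unsplit pt k<m same)))
  , λ path → [ id , (λ split → contradiction path
      (let ¬km , ¬mk = split⇒disconnected (All-reverse (chains-increasing pt)) (Any.reverse⁺ split) in [ ¬km , ¬mk ]′)) ]′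
      (same-or-split pt 0<k k<m m≤n)

runs⇔regions : ∀ {n t k m} → Preorder 0 t n → 0 < k → k ≤ n → 0 < m → m ≤ n →
  SameBlock (runs t) k m ⇔ SameRegion (reverse (chains t)) (halfPoint k) (halfPoint m)
runs⇔regions {n} {t} {k} {m} pt 0<k k≤n 0<m m≤n = by-cases (<-cmp k m)
  where
  by-cases : Tri (k < m) (k ≡ m) (m < k) →
    SameBlock (runs t) k m ⇔ SameRegion (reverse (chains t)) (halfPoint k) (halfPoint m)
  by-cases (tri≈ _ refl _) =
    mk⇔ (λ _ → ε) (λ _ → SameBlock-refl (∈-resp-↭ (↭-sym (word-runs t)) (labels⁺ pt 0<k k≤n)))
  by-cases (tri< k<m _ _) = let to , from = runs⇔regions-< pt 0<k k<m m≤n in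
    mk⇔ (λ same → to same ◅ ε) (from ∘ inj₁)
  by-cases (tri> _ _ m<k) = let to , from = runs⇔regions-< pt 0<m m<k k≤n in
    mk⇔ (λ same → segment-reverse {z = halfPoint m} {halfPoint k} (to (SameBlock-sym same)) ◅ ε) (SameBlock-sym ∘ from ∘ inj₂)

bar-preorder : ∀ {n t} → Preorder 0 t n → bar n (φ t) ≡ reverse (map (List⁺.map (suc n ∸_)) (runs t))
bar-preorder {n} {t} pt = trans (cong (slash ∘ map (suc n ∸_)) (word-φ t))
  (slash-antitone (suc n ∸_) pt (λ _ p<q q≤n → ∸-monoʳ-< p<q (m≤n⇒m≤1+n q≤n)))

bar-kreweras : ∀ {n t} → Preorder 0 t n → bar n (φ t) ≡ reverse (chains (kreweras (suc n ∸_) t))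
bar-kreweras {n} {t} pt = trans (bar-preorder pt) (cong reverse (sym (chains-kreweras (suc n ∸_) t)))

preorder-complement : ∀ {n t} → Preorder 0 t n → Preorder 0 (kreweras (suc n ∸_) t) n
preorder-complement {n} {t} pt = subst (λ a → Preorder a (kreweras (suc n ∸_) t) n) (n∸n≡0 n)
  (preorder-kreweras pt ≤-refl)

complement-≤ : ∀ {n i} → 0 < i → suc n ∸ i ≤ n
complement-≤ {n} {suc i} _ = m∸n≤m n i

bar⇔runs : ∀ {n t i j} → Preorder 0 t n → i ≤ n → j ≤ n →
  SameBlock (bar n (φ t)) i j ⇔ SameBlock (runs t) (suc n ∸ i) (suc n ∸ j)
bar⇔runs {n} {t} {i} {j} pt i≤n j≤n = mk⇔
  (λ same → lower (Any.map⁻ (Any.reverse⁻ (subst (λ π → SameBlock π i j) (bar-preorder pt) same))))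
  (λ same → subst (λ π → SameBlock π i j) (sym (bar-preorder pt)) (Any.reverse⁺ (Any.map⁺
    (Any.map (λ {B} (i∈ , j∈) → raise {B = B} i≤n i∈ , raise {B = B} j≤n j∈) same))))
  where
  f = suc n ∸_
  raise : ∀ {i B} → i ≤ n → f i ∈ letters B → i ∈ letters (List⁺.map f B)
  raise {i} {B} i≤n fi∈ = subst (_∈ letters (List⁺.map f B)) (m∸[m∸n]≡n (m≤n⇒m≤1+n i≤n)) (∈-map⁺ f fi∈)
  unraise : ∀ {i B} → B ∈ runs t → i ∈ letters (List⁺.map f B) → f i ∈ letters B
  unraise {i} {B} B∈ i∈ with ∈-map⁻ f {xs = letters B} i∈
  ... | p , p∈ , refl = subst (_∈ letters B)
    (sym (m∸[m∸n]≡n (m≤n⇒m≤1+n (proj₂ (runs-bounds pt (∈-word⁺ {b = B} B∈ p∈)))))) p∈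
  lower : Any (λ B → i ∈ letters (List⁺.map f B) × j ∈ letters (List⁺.map f B)) (runs t) →
    SameBlock (runs t) (f i) (f j)
  lower s with find s
  ... | B , B∈ , i∈ , j∈ = lose B∈ (unraise {B = B} B∈ i∈ , unraise {B = B} B∈ j∈)

bar⇔regions : ∀ {n t} → Preorder 0 t n → ∀ i j → 1 ≤ i → i ≤ n → 1 ≤ j → j ≤ n →
  SameBlock (bar n (φ t)) i j ⇔ SameRegion (reverse (chains t)) (primed n i) (primed n j)
bar⇔regions {n} {t} pt i j 1≤i i≤n 1≤j j≤n =
  subst₂ (λ z w → SameBlock (bar n (φ t)) i j ⇔ SameRegion (reverse (chains t)) z w)
    (sym (primed-halfPoint n i≤n)) (sym (primed-halfPoint n j≤n))
    (runs⇔regions pt (m<n⇒0<n∸m (s≤s i≤n)) (complement-≤ 1≤i) (m<n⇒0<n∸m (s≤s j≤n)) (complement-≤ 1≤j)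
      ⇔-∘ bar⇔runs pt i≤n j≤n)

-- A canonical partition is determined by its block relation.

block-unique : ∀ {π b c p} → Unique (word π) → b ∈ π → c ∈ π → p ∈ letters b → p ∈ letters c → b ≡ c
block-unique {d ∷ π} π! b∈ c∈ p∈b p∈c with AllPairs-++⁻ (letters d) π!
block-unique {d ∷ π} π! (here refl) (here refl) p∈b p∈c | _ = refl
block-unique {d ∷ π} π! (here refl) (there c∈)  p∈b p∈c | _ , _ , disjoint =
  contradiction refl (disjoint p∈b (∈-word⁺ c∈ p∈c))
block-unique {d ∷ π} π! (there b∈)  (here refl) p∈b p∈c | _ , _ , disjoint =
  contradiction refl (disjoint p∈c (∈-word⁺ b∈ p∈b))
block-unique {d ∷ π} π! (there b∈)  (there c∈)  p∈b p∈c | _ , π!′ , _ = block-unique π!′ b∈ c∈ p∈b p∈c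

-- The relation fixes the blocks as sets, increasing letters fix each block, and decreasing minima
-- fix their order. This gives the single-valuedness of α′.
NCP-unique : ∀ {n π ρ} → NCP n π → NCP n ρ →
  (∀ i j → 1 ≤ i → i ≤ n → 1 ≤ j → j ≤ n → SameBlock π i j ⇔ SameBlock ρ i j) → π ≡ ρ
NCP-unique {n} {π} {ρ} ncpπ ncpρ same⇔ = sorted-unique {R = flip MinB<} (λ p q → <-asym p q)
  (canonical ncpπ) (canonical ncpρ)
  (block∈ ncpπ ncpρ same⇔) (block∈ ncpρ ncpπ λ i j 1≤i i≤n 1≤j j≤n → ⇔-sym (same⇔ i j 1≤i i≤n 1≤j j≤n))
  where
  canonical : ∀ {π} → NCP n π → AllPairs (flip MinB<) π
  canonical ncp = Linked⇒AllPairs (λ p q → <-trans q p) (NCP.canonical ncp)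
  enumerates : ∀ {π} → NCP n π → Enumerates 0 n (word π)
  enumerates ncp = ↭⇒Enumerates (NCCP.exactlyOnce (NCP.nccp ncp))
  module _ {π ρ} (ncpπ : NCP n π) (ncpρ : NCP n ρ)
    (same⇔ : ∀ i j → 1 ≤ i → i ≤ n → 1 ≤ j → j ≤ n → SameBlock π i j ⇔ SameBlock ρ i j) where
    blocks↗ : ∀ {π} → NCP n π → All IncreasingBlock π
    blocks↗ ncp = NCCP.increasing (NCP.nccp ncp)
    transfer : ∀ {i j} → SameBlock π i j → SameBlock ρ i j
    transfer {i} {j} same =
      let 0<i , i≤n = proj₁ (proj₂ (enumerates ncpπ)) (SameBlock⇒∈ same)
          0<j , j≤n = proj₁ (proj₂ (enumerates ncpπ)) (SameBlock⇒∈ (SameBlock-sym same))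
      in Equivalence.to (same⇔ i j 0<i i≤n 0<j j≤n) same
    transfer⁻ : ∀ {i j} → SameBlock ρ i j → SameBlock π i j
    transfer⁻ {i} {j} same =
      let 0<i , i≤n = proj₁ (proj₂ (enumerates ncpρ)) (SameBlock⇒∈ same)
          0<j , j≤n = proj₁ (proj₂ (enumerates ncpρ)) (SameBlock⇒∈ (SameBlock-sym same))
      in Equivalence.from (same⇔ i j 0<i i≤n 0<j j≤n) same
    incl : ∀ {π b p q} → NCP n π → b ∈ π → p ∈ letters b → SameBlock π p q → q ∈ letters b
    incl {q = q} ncp b∈ p∈ same with find same
    ... | c , c∈ , p∈c , q∈c = subst (λ d → q ∈ letters d)
      (block-unique (proj₁ (enumerates ncp)) c∈ b∈ p∈c p∈) q∈c
    block∈ : ∀ {b} → b ∈ π → b ∈ ρ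
    -- Transferring the pair of x with itself finds the block of ρ that contains x.
    block∈ {b@(x ∷ xs)} b∈ with find (transfer (lose {P = λ b → x ∈ letters b × x ∈ letters b} b∈ (here refl , here refl)))
    ... | c , c∈ , x∈c , _ = subst (_∈ ρ) (letters-injective (sym b≡c)) c∈
      where
      letters-injective : ∀ {b c : Block} → letters b ≡ letters c → b ≡ c
      letters-injective refl = refl
      b≡c : letters b ≡ letters c
      b≡c = sorted-unique <-asym
        (increasing⇒AllPairs b (All.lookup (blocks↗ ncpπ) b∈)) (increasing⇒AllPairs c (All.lookup (blocks↗ ncpρ) c∈))
        (λ p∈ → incl ncpρ c∈ x∈c (transfer (lose b∈ (here refl , p∈))))
        (λ p∈ → incl ncpπ b∈ (here refl) (transfer⁻ (lose c∈ (x∈c , p∈))))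

-- The arrows of the square.

tree-of-avoiding : ∀ {n π} → NCCP-avoiding n p312 π → ∃[ t ] Preorder 0 t n × φ t ≡ π
tree-of-avoiding {n} {π} (nccp , avoid)
  with tree-of-word n ≤-refl z≤n (↭⇒Enumerates (NCCP.exactlyOnce nccp)) (avoid312⇒Avoids avoid)
... | t , pt , eq = t , pt , trans (cong slash eq) (slash-word-NCCP nccp)

φ-avoiding : ∀ {n t} → Preorder 0 t n → NCCP-avoiding n p312 (φ t)
φ-avoiding {t = t} pt = slash-NCCP (Enumerates⇒↭ (preorder-Enumerates pt))
  , subst (¬_ ∘ Contains p312) (sym (word-φ t)) (Avoids⇒avoid312 (preorder-Avoids pt))

-- A competing tree is only known to be increasing; equal in-order words identify it with t.
ψ∘φ⁻¹-φ : ∀ {n t} → Preorder 0 t n → ψ∘φ⁻¹ n ∶ φ t ↦ ψ t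
ψ∘φ⁻¹-φ {t = t} pt = (t , preorder-LabeledTree pt , refl , refl) , λ z (s , labeled , φs≡φt , ψs≡z) →
  trans (sym ψs≡z) (cong ψ (heap-unique (LabeledTree.increasing labeled) (preorder-Increasing pt)
    (trans (sym (word-φ s)) (trans (cong word φs≡φt) (word-φ t)))))

ψ-kreweras : ∀ {n t} → Preorder 0 t n → ψ (kreweras (suc n ∸_) t) ≡ bar n (φ t)
ψ-kreweras pt = trans (ψ-preorder (preorder-complement pt)) (sym (bar-kreweras pt))

ψ-NCP : ∀ {n t} → Preorder 0 t n → NCP n (ψ t)
ψ-NCP {n} pt = subst (NCP n) (sym (ψ-preorder pt)) (chains-NCP pt)

ψ-injective : ∀ {n s t} → Preorder 0 s n → Preorder 0 t n → ψ s ≡ ψ t → s ≡ t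
ψ-injective ps pt eq = chains-injective ps pt (List.reverse-injective
  (trans (sym (ψ-preorder ps)) (trans eq (ψ-preorder pt))))

-- Avoidance of 312 supplies a preorder-labelled tree for any competing value, and on such trees `ψ`
-- is injective.
φ∘ψ⁻¹-ψ : ∀ {n t} → Preorder 0 t n → φ∘ψ⁻¹ n ∶ ψ t ↦ φ t
φ∘ψ⁻¹-ψ {n} {t} pt = (φ-avoiding pt , proj₁ (ψ∘φ⁻¹-φ pt)) , unique
  where
  unique : ∀ z → φ∘ψ⁻¹ n (ψ t) z → z ≡ φ t
  unique z (avoiding-z , z↦) with tree-of-avoiding avoiding-z
  ... | u , pu , refl = cong φ (ψ-injective pu pt (sym (proj₂ (ψ∘φ⁻¹-φ pu) (ψ t) z↦)))

α′-ψ : ∀ {n t} → Preorder 0 t n → α′ n ∶ ψ t ↦ bar n (φ t)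
α′-ψ {n} {t} pt = (ncp-bar , regions) , λ z (ncp-z , regions-z) →
  NCP-unique ncp-z ncp-bar λ i j 1≤i i≤n 1≤j j≤n →
    ⇔-sym (regions i j 1≤i i≤n 1≤j j≤n) ⇔-∘ regions-z i j 1≤i i≤n 1≤j j≤n
  where
  ncp-bar : NCP n (bar n (φ t))
  ncp-bar = subst (NCP n) (ψ-kreweras pt) (ψ-NCP (preorder-complement pt))
  regions : ∀ i j → 1 ≤ i → i ≤ n → 1 ≤ j → j ≤ n →
    SameBlock (bar n (φ t)) i j ⇔ SameRegion (ψ t) (primed n i) (primed n j)
  regions = subst (λ σ → ∀ i j → 1 ≤ i → i ≤ n → 1 ≤ j → j ≤ n →
      SameBlock (bar n (φ t)) i j ⇔ SameRegion σ (primed n i) (primed n j))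
    (sym (ψ-preorder pt)) (bar⇔regions pt)

-- The conclusion as a predicate of π, for transport along `φ t ≡ π`.
Commutes : ℕ → Blocks → Set
Commutes n π = ∃[ ρ ] ∃[ σ ]
    NCCP-avoiding n p312 ρ × NCP n σ × NCP n (bar n π)
    × (α n ∶ π ↦ ρ)
    × (ψ∘φ⁻¹ n ∶ π ↦ σ)
    × (ψ∘φ⁻¹ n ∶ ρ ↦ bar n π)
    × (α′ n ∶ σ ↦ bar n π)

φ-commutes : ∀ {n t} → Preorder 0 t n → Commutes n (φ t)
φ-commutes {n} {t} pt =
    φ s , ψ t , φ-avoiding ps , ψ-NCP pt , subst (NCP n) (ψ-kreweras pt) (ψ-NCP ps)
  , subst (φ∘ψ⁻¹ n ∶_↦ φ s) (ψ-kreweras pt) (φ∘ψ⁻¹-ψ ps)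
  , ψ∘φ⁻¹-φ pt
  , subst (ψ∘φ⁻¹ n ∶ φ s ↦_) (ψ-kreweras pt) (ψ∘φ⁻¹-φ ps)
  , α′-ψ pt
  where
  s = kreweras (suc n ∸_) t
  ps : Preorder 0 s n
  ps = preorder-complement pt

proposition3p36 : (n : ℕ) → 1 ≤ n →
    (π : Blocks) → NCCP-avoiding n p312 π →
    ∃[ ρ ] ∃[ σ ]
    NCCP-avoiding n p312 ρ × NCP n σ × NCP n (bar n π)
    × (α n ∶ π ↦ ρ)
    × (ψ∘φ⁻¹ n ∶ π ↦ σ)
    × (ψ∘φ⁻¹ n ∶ ρ ↦ bar n π)
    × (α′ n ∶ σ ↦ bar n π)
proposition3p36 n _ π avoiding =
  let t , pt , φt≡π = tree-of-avoiding avoiding in subst (Commutes n) φt≡π (φ-commutes pt)
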